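{- For every finite alphabet $\Sigma$ and every formula $\varphi\in\mathsf{MTL}^{pw}[\mathcal{U}_I,\mathcal{S}_{NS}]$ over $\Sigma$, one can construct a finite alphabet $\Sigma''\supseteq\Sigma$ and a formula $\psi\in\mathsf{MTL}^{pw}[\mathcal{U}_I]$ over $\Sigma''$ such that: (1) for every finite timed word $\rho'$ over $\Sigma''$, if $\rho'\models\psi$ then the projection $\rho'\upharpoonright\Sigma$ satisfies $\varphi$; (2) for every finite timed word $\rho$ over $\Sigma$, if $\rho\models\varphi$ then there exists a finite timed word $\rho'$ over $\Sigma''$ such that $\rho'\models\psi$ and $\rho'$ is a $\Sigma''$-oversampling of $\rho$.
   Context: A finite timed word over a finite alphabet $\Gamma$ is a sequence $(A_1,t_1)\dots(A_n,t_n)$, $n\ge1$, with each $A_i$ a nonempty subset of $\Gamma$, $t_i\in\mathbb{R}_{\ge0}$, $t_1<\dots<t_n$. MTL formulae over $\Gamma$: $\varphi::=a\ (a\in\Gamma)\mid BP\mid EP\mid true\mid\varphi\wedge\varphi\mid\neg\varphi\mid\varphi\,\mathcal{U}_I\,\varphi\mid\varphi\,\mathcal{S}_I\,\varphi$, with $I$ an open, half-open or closed interval with endpoints in $\mathbb{N}\cup\{\infty\}$. Pointwise semantics at position $i$: $a$ holds iff $a\in A_i$; $BP$ holds exactly at the first position, $EP$ exactly at the last; booleans as usual; $\rho,i\models\varphi_1\mathcal{U}_I\varphi_2$ iff $\exists j>i$ with $\rho,j\models\varphi_2$, $t_j-t_i\in I$ and $\rho,k\models\varphi_1$ for all $i<k<j$;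 $\mathcal{S}_I$ is the mirror image ($j<i$, $t_i-t_j\in I$, $\varphi_1$ at all $j<k<i$). $\rho\models\varphi$ means satisfaction at the first position. An interval is non-singular if it is not of the form $[c,c]$. $\mathsf{MTL}^{pw}[\mathcal{U}_I,\mathcal{S}_{NS}]$: formulae where $\mathcal{U}$ has arbitrary intervals and every $\mathcal{S}$ has a non-singular interval. $\mathsf{MTL}^{pw}[\mathcal{U}_I]$: formulae with no $\mathcal{S}$ operator at all. For $\Sigma\subseteq\Sigma''$ and a timed word $\rho'=(Y_1,t'_1)\dots(Y_m,t'_m)$ over $\Sigma''$, the projection $\rho'\upharpoonright\Sigma$ is obtained by first replacing each $Y_i$ by $Y_i\cap\Sigma$ and then deleting all positions whose label has become empty. A position $i$ of $\rho'$ is an action point if $Y_i\cap\Sigma\ne\emptyset$. $\rho'$ is a $\Sigma''$-oversampling of a timed word $\rho$ over $\Sigma$ if $\rho'\upharpoonright\Sigma=\rho$ and the first and last positions of $\rho'$ are action points. -}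

module Defs where

open import Level using (0ℓ)
open import Data.Bool using (Bool; true; false; _∨_; if_then_else_)
open import Data.Nat as ℕ using (ℕ; zero; suc)
open import Data.Fin as Fin using (Fin; zero; suc; toℕ)
open import Data.Fin.Subset using (Subset; _∈_; Nonempty)
open import Data.Vec as Vec using (Vec; take)
open import Data.List as List using (List; []; _∷_; length)
open import Data.List.Relation.Unary.All using (All)
open import Data.List.Relation.Unary.Linked using (Linked)
open import Data.Maybe using (Maybe; just; nothing)
open import Data.Product using (Σ; ∃; _×_; _,_; proj₁; proj₂)
open import Data.Sum using (_⊎_)
open import Data.Unit using (⊤)
open import Data.Empty using (⊥)
open import Relation.Nullary using (¬_)
open import Relation.Binary using (Rel; IsStrictTotalOrder)
open import Relation.Binary.PropositionalEquality using (_≡_; _≢_)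
open import Algebra.Structures using (IsCommutativeRing)

-- The time domain: a model of the real numbers
-- (a complete ordered field; all such are isomorphic to ℝ).

record RealLine : Set₁ where
  infixl 6 _+_
  infixl 7 _*_
  infix 4 _<_
  field
    Carrier : Set
    _+_ _*_ : Carrier → Carrier → Carrier
    -_ : Carrier → Carrier
    0# 1# : Carrier
    _<_ : Rel Carrier 0ℓ
    isCommutativeRing  : IsCommutativeRing _≡_ _+_ _*_ -_ 0# 1#
    isStrictTotalOrder : IsStrictTotalOrder _≡_ _<_
    +-mono-<  : ∀ {x y} z → x < y → x + z < y + z
    *-pos     : ∀ {x y} → 0# < x → 0# < y → 0# < x * y
    0<1       : 0# < 1#
    inverse   : ∀ x → x ≢ 0# → ∃ λ y → x * y ≡ 1#
    complete  : ∀ (P : Carrier → Set) → (∃ P)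
              → (∃ λ b → ∀ x → P x → (x < b ⊎ x ≡ b))
              → ∃ λ s → (∀ x → P x → (x < s ⊎ x ≡ s))
                      × (∀ b → (∀ x → P x → (x < b ⊎ x ≡ b)) → (s < b ⊎ s ≡ b))

-- Intervals with endpoints in ℕ ∪ {∞} (lower endpoint in ℕ;
-- an upper endpoint ∞ is always open).

record Interval : Set where
  constructor interval
  field
    lo       : ℕ
    loClosed : Bool
    hi       : Maybe ℕ      -- nothing = ∞
    hiClosed : Bool         -- ignored when hi = nothing

Singular : Interval → Set
Singular I = Interval.loClosed I ≡ true × Interval.hiClosed I ≡ true
           × Interval.hi I ≡ just (Interval.lo I)

NonSingular : Interval → Set
NonSingular I = ¬ Singular I

data Form (A : Set) : Set where
  atom : A → Form A
  BP EP tt : Form A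
  _∧_ : Form A → Form A → Form A
  ¬' : Form A → Form A
  U[_] : Interval → Form A → Form A → Form A
  S[_] : Interval → Form A → Form A → Form A

data SinceNS {A : Set} : Form A → Set where
  atom : ∀ a → SinceNS (atom a)
  BP : SinceNS BP
  EP : SinceNS EP
  tt : SinceNS tt
  _∧_ : ∀ {φ ψ} → SinceNS φ → SinceNS ψ → SinceNS (φ ∧ ψ)
  ¬' : ∀ {φ} → SinceNS φ → SinceNS (¬' φ)
  U[_] : ∀ I {φ ψ} → SinceNS φ → SinceNS ψ → SinceNS (U[ I ] φ ψ)
  S[_] : ∀ {I φ ψ} → NonSingular I → SinceNS φ → SinceNS ψ → SinceNS (S[ I ] φ ψ)

data FutureOnly {A : Set} : Form A → Set where
  atom : ∀ a → FutureOnly (atom a)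
  BP : FutureOnly BP
  EP : FutureOnly EP
  tt : FutureOnly tt
  _∧_ : ∀ {φ ψ} → FutureOnly φ → FutureOnly ψ → FutureOnly (φ ∧ ψ)
  ¬' : ∀ {φ} → FutureOnly φ → FutureOnly (¬' φ)
  U[_] : ∀ I {φ ψ} → FutureOnly φ → FutureOnly ψ → FutureOnly (U[ I ] φ ψ)

module Semantics (ℝ : RealLine) where
  open RealLine ℝ

  R : Set
  R = Carrier

  _≤_ : R → R → Set
  x ≤ y = x < y ⊎ x ≡ y

  fromℕ : ℕ → R
  fromℕ zero    = 0#
  fromℕ (suc n) = 1# + fromℕ n

  _∈I_ : R → Interval → Set
  d ∈I interval lo lc hi hc = lower lc × upper hi hc
    where
      lower : Bool → Set
      lower true  = fromℕ lo ≤ d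
      lower false = fromℕ lo < d
      upper : Maybe ℕ → Bool → Set
      upper nothing  _     = ⊤
      upper (just h) true  = d ≤ fromℕ h
      upper (just h) false = d < fromℕ h

  Word : ℕ → Set
  Word n = List (Subset n × R)

  times : ∀ {n} → Word n → List R
  times = List.map proj₂

  IsTimedWord : ∀ {n} → Word n → Set
  IsTimedWord ρ = 0 ℕ.< length ρ
                × All (λ p → Nonempty (proj₁ p)) ρ
                × All (λ p → 0# ≤ proj₂ p) ρ
                × Linked _<_ (times ρ)

  lab : ∀ {n} (ρ : Word n) → Fin (length ρ) → Subset n
  lab ρ i = proj₁ (List.lookup ρ i)

  time : ∀ {n} (ρ : Word n) → Fin (length ρ) → R
  time ρ i = proj₂ (List.lookup ρ i)

  Sat : ∀ {n} (ρ : Word n) → Fin (length ρ) → Form (Fin n) → Set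
  Sat ρ i (atom a) = a ∈ lab ρ i
  Sat ρ i BP = toℕ i ≡ 0
  Sat ρ i EP = suc (toℕ i) ≡ length ρ
  Sat ρ i tt = ⊤
  Sat ρ i (φ ∧ ψ) = Sat ρ i φ × Sat ρ i ψ
  Sat ρ i (¬' φ) = ¬ Sat ρ i φ
  Sat ρ i (U[ I ] φ ψ) = ∃ λ j → i Fin.< j × Sat ρ j ψ
    × ((time ρ j + - time ρ i) ∈I I)
    × (∀ k → i Fin.< k → k Fin.< j → Sat ρ k φ)
  Sat ρ i (S[ I ] φ ψ) = ∃ λ j → j Fin.< i × Sat ρ j ψ
    × ((time ρ i + - time ρ j) ∈I I)
    × (∀ k → j Fin.< k → k Fin.< i → Sat ρ k φ)

  _⊨_ : ∀ {n} → Word n → Form (Fin n) → Set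
  [] ⊨ φ = ⊥
  (x ∷ xs) ⊨ φ = Sat (x ∷ xs) zero φ

  anyTrue : ∀ {m} → Vec Bool m → Bool
  anyTrue = Vec.foldr _ _∨_ false

  -- projection ρ' ↾ Σ, where Σ = Fin n ⊆ Σ'' = Fin (n + k) (first n letters)
  proj : ∀ n {k} → Word (n ℕ.+ k) → Word n
  proj n [] = []
  proj n ((Y , t) ∷ ρ) =
    if anyTrue (take n Y) then (take n Y , t) ∷ proj n ρ else proj n ρ

  ActionPoint : ∀ n {k} → Subset (n ℕ.+ k) × R → Set
  ActionPoint n (Y , t) = Nonempty (take n Y)

  Oversampling : ∀ n {k} → Word (n ℕ.+ k) → Word n → Set
  Oversampling n ρ' ρ = proj n ρ' ≡ ρ
    × (∀ x → List.head ρ' ≡ just x → ActionPoint n x)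
    × (∀ x → List.last ρ' ≡ just x → ActionPoint n x)

{-# OPTIONS --safe #-}
module Submission where

-- Each subformula β S_I γ, with I of endpoints l < u, is replaced by a letter w, whose completeness is the
-- future formula γ ⇒ ¬ (β U_I ¬w).  For its soundness, consider the times t_j + I of the γ-positions j in a
-- stretch of β: as I is not singular, their union consists of components of length at least 1.  A position
-- that starts a component is a source (letter a) and gets a mark (letter b) exactly l later; a position that
-- ends one gets an end mark (letter e) exactly u later.  Then w may be forbidden from an end mark, from a
-- failure of β, and from the beginning of the word, up to the next b.  Spurious end marks do no harm; spurious
-- b are excluded because b occurs at most once per unit of time, so it suffices to require that every position
-- seeing some b at a distance in [l+k, l+k+1) also sees a source at a distance in [k, k+1), for k < l; after a
-- gap longer than l, no b may occur for l time units.
-- The number of added positions is bounded in terms of the length of the word alone.  This is essential: the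
-- Archimedean property, needed for instance for a grid of integer times, has no constructive proof from the
-- axioms of RealLine.

open import Defs renaming (_∧_ to infixr 6 _∧_)
open import Algebra.Structures using (IsCommutativeRing)
open import Data.Bool using (Bool; true; false; not; if_then_else_) renaming (_∨_ to _or_)
open import Data.Empty using (⊥)
open import Data.Fin as Fin using (Fin; zero; suc; toℕ; _↑ˡ_; _↑ʳ_)
import Data.Fin.Properties as Fin
open import Data.Fin.Subset using (Subset; _∈_; Nonempty)
import Data.Fin.Subset.Properties as Subset
open import Data.List as List using (List; []; _∷_; length)
open import Data.List.Membership.Propositional using () renaming (_∈_ to _∈ᴸ_)
open import Data.List.Membership.Propositional.Properties using (∈-map⁺; ∈-map⁻; ∈-lookup; ∈-allFin; ∈-cartesianProductWith⁺)
open import Data.List.Properties using (map-∘)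
open import Data.List.Relation.Unary.All as All using (All; []; _∷_)
import Data.List.Relation.Unary.All.Properties as All
open import Data.List.Relation.Unary.AllPairs using (AllPairs; []; _∷_)
open import Data.List.Relation.Unary.Any as Any using (here; there)
import Data.List.Relation.Unary.Any.Properties as Any
open import Data.List.Relation.Unary.Linked using (Linked)
open import Data.List.Relation.Unary.Linked.Properties using (Linked⇒AllPairs; AllPairs⇒Linked)
open import Data.Maybe as Maybe using (Maybe; just; nothing)
open import Data.Nat as ℕ using (ℕ; zero; suc; z≤n; s≤s)
import Data.Nat.Properties as ℕ
open import Data.Product using (Σ; ∃; _×_; _,_; proj₁; proj₂)
open import Data.Sum using (_⊎_; inj₁; inj₂; [_,_]′)
open import Data.Unit using (⊤)
open import Data.Vec as Vec using (Vec; []; _∷_; take; lookup)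
import Data.Vec.Properties as Vec
open import Function using (_∘_)
open import Relation.Binary using (IsStrictTotalOrder; IsTotalOrder; tri<; tri≈; tri>)
import Relation.Binary.Construct.StrictToNonStrict as StrictToNonStrict
open import Relation.Binary.PropositionalEquality using (_≡_; refl; sym; trans; cong; cong₂; subst; subst₂)
open import Relation.Nullary using (¬_; Dec; yes; no; does; contradiction)
open import Relation.Nullary.Decidable using (map′; _×-dec_; _→-dec_; ¬?; decidable-stable; dec-true)

-- That every source has a mark is a statement about the future, but that every mark has a source is
-- one about the past; this asymmetry shapes the constraints. A spurious end mark can only forbid
-- `w`, which never endangers soundness, whereas a spurious `b` would permit it; hence only `b` has
-- to be traced back. The unit of time comes from the integer endpoints: `l < u` gives `u - l ≥ 1`,
-- so a position less than one unit after a source, in the same stretch of `β`, belongs to the same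
-- component and is not a source itself. Thus a unit window holds at most one mark, and if the
-- window shifted back by `l` contains a source, the mark of this source is the only candidate. The
-- mark of a source vouches for `β` only up to the mark; from there on, each failure of `β` cancels
-- the permission by itself.

module Line (ℝ : RealLine) where
  open RealLine ℝ using (_+_; -_; 0#; 1#; _<_; isCommutativeRing; isStrictTotalOrder; +-mono-<; 0<1)
  open Semantics ℝ using (R; fromℕ; _∈I_) renaming (_≤_ to infix 4 _≤_)
  open IsCommutativeRing isCommutativeRing using (+-assoc; +-comm; +-identityʳ; +-identityˡ; -‿inverseˡ; -‿inverseʳ)
  open IsStrictTotalOrder isStrictTotalOrder using (compare; _<?_; _≟_) renaming (trans to <-trans; irrefl to <-irrefl) public
  private module S = IsStrictTotalOrder isStrictTotalOrder
  open StrictToNonStrict _≡_ _<_ using () renaming (decidable′ to ≤-dec; isTotalOrder to ≤-isTotalOrder)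
  open IsTotalOrder (≤-isTotalOrder isStrictTotalOrder) using () renaming (trans to ≤-trans; antisym to ≤-antisym) public

  -- Order and natural offsets on the time line.

  infix 4 _≤?_
  _≤?_ : ∀ x y → Dec (x ≤ y)
  _≤?_ = ≤-dec compare

  ≤-refl : ∀ {x} → x ≤ x
  ≤-refl = inj₂ refl

  <-≤-trans : ∀ {x y z} → x < y → y ≤ z → x < z
  <-≤-trans = StrictToNonStrict.<-≤-trans _≡_ _<_ <-trans S.<-respʳ-≈

  ≤-<-trans : ∀ {x y z} → x ≤ y → y < z → x < z
  ≤-<-trans = StrictToNonStrict.≤-<-trans _≡_ _<_ sym <-trans S.<-respˡ-≈

  <⇒≱ : ∀ {x y} → x < y → ¬ (y ≤ x)
  <⇒≱ x<y y≤x = <-irrefl refl (<-≤-trans x<y y≤x)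

  ≰⇒> : ∀ {x y} → ¬ (x ≤ y) → y < x
  ≰⇒> {x} {y} x≰y with compare x y
  ... | tri< x<y _ _ = contradiction (inj₁ x<y) x≰y
  ... | tri≈ _ x≡y _ = contradiction (inj₂ x≡y) x≰y
  ... | tri> _ _ y<x = y<x

  ≮⇒≥ : ∀ {x y} → ¬ (x < y) → y ≤ x
  ≮⇒≥ {x} {y} x≮y with compare x y
  ... | tri< x<y _ _ = contradiction x<y x≮y
  ... | tri≈ _ x≡y _ = inj₂ (sym x≡y)
  ... | tri> _ _ y<x = inj₁ y<x

  infixl 6 _⊕_
  _⊕_ : R → ℕ → R
  x ⊕ n = x + fromℕ n

  ⊕-identityʳ : ∀ x → x ⊕ 0 ≡ x
  ⊕-identityʳ = +-identityʳ

  fromℕ-+ : ∀ m n → fromℕ (m ℕ.+ n) ≡ fromℕ m + fromℕ n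
  fromℕ-+ zero    n = sym (+-identityˡ _)
  fromℕ-+ (suc m) n = trans (cong (1# +_) (fromℕ-+ m n)) (sym (+-assoc _ _ _))

  ⊕-⊕ : ∀ x m n → x ⊕ m ⊕ n ≡ x ⊕ (m ℕ.+ n)
  ⊕-⊕ x m n = trans (+-assoc _ _ _) (cong (x +_) (sym (fromℕ-+ m n)))

  ⊕-mono-< : ∀ {x y} n → x < y → x ⊕ n < y ⊕ n
  ⊕-mono-< n = +-mono-< (fromℕ n)

  ⊕-mono-≤ : ∀ {x y} n → x ≤ y → x ⊕ n ≤ y ⊕ n
  ⊕-mono-≤ n (inj₁ x<y) = inj₁ (⊕-mono-< n x<y)
  ⊕-mono-≤ n (inj₂ x≡y) = inj₂ (cong (_⊕ n) x≡y)

  ⊕-cancel-< : ∀ {x y} n → x ⊕ n < y ⊕ n → x < y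
  ⊕-cancel-< n p = ≰⇒> λ y≤x → <⇒≱ p (⊕-mono-≤ n y≤x)

  ⊕-cancel-≤ : ∀ {x y} n → x ⊕ n ≤ y ⊕ n → x ≤ y
  ⊕-cancel-≤ n p = ≮⇒≥ λ y<x → <⇒≱ (⊕-mono-< n y<x) p

  fromℕ-nonneg : ∀ n → 0# ≤ fromℕ n
  fromℕ-pos : ∀ n → 0# < fromℕ (suc n)
  fromℕ-nonneg zero    = ≤-refl
  fromℕ-nonneg (suc n) = inj₁ (fromℕ-pos n)
  fromℕ-pos n = <-≤-trans 0<1 (subst (_≤ 1# + fromℕ n) (+-identityʳ 1#) (+-monoʳ-≤ 1# (fromℕ-nonneg n)))
    where
    +-monoʳ-≤ : ∀ z {x y} → x ≤ y → z + x ≤ z + y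
    +-monoʳ-≤ z (inj₁ x<y) = inj₁ (subst₂ _<_ (+-comm _ _) (+-comm _ _) (+-mono-< z x<y))
    +-monoʳ-≤ z (inj₂ x≡y) = inj₂ (cong (z +_) x≡y)

  x<x⊕n : ∀ {x n} → 0 ℕ.< n → x < x ⊕ n
  x<x⊕n {x} {suc n} _ = subst₂ _<_ (+-identityˡ x) (+-comm _ _) (+-mono-< x (fromℕ-pos n))

  x≤x⊕n : ∀ {x} n → x ≤ x ⊕ n
  x≤x⊕n zero    = inj₂ (sym (⊕-identityʳ _))
  x≤x⊕n (suc n) = inj₁ (x<x⊕n {n = suc n} (s≤s z≤n))

  ⊕-monoʳ-≤ : ∀ x {m n} → m ℕ.≤ n → x ⊕ m ≤ x ⊕ n
  ⊕-monoʳ-≤ x {m} {n} m≤n = subst (x ⊕ m ≤_) (trans (⊕-⊕ x m (n ℕ.∸ m)) (cong (x ⊕_) (ℕ.m+[n∸m]≡n m≤n)))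
      (x≤x⊕n (n ℕ.∸ m))

  ⊕-monoʳ-< : ∀ x {m n} → m ℕ.< n → x ⊕ m < x ⊕ n
  ⊕-monoʳ-< x {m} {n} m<n = subst (x ⊕ m <_) (trans (⊕-⊕ x m (n ℕ.∸ m))
      (cong (x ⊕_) (ℕ.m+[n∸m]≡n (ℕ.<⇒≤ m<n)))) (x<x⊕n (ℕ.m<n⇒0<n∸m m<n))

  ⊕-∸ : ∀ x {m n} → m ℕ.≤ n → x ⊕ (n ℕ.∸ m) ⊕ m ≡ x ⊕ n
  ⊕-∸ x {m} {n} m≤n = trans (⊕-⊕ x (n ℕ.∸ m) m) (cong (x ⊕_) (ℕ.m∸n+n≡m m≤n))

  -- The search for the integer part is bounded by the given `l`, so that recursion on `l` replaces
  -- the Archimedean property.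
  floor : ∀ l {x y} → x ≤ y → y < x ⊕ l → ∃ λ k → k ℕ.< l × x ⊕ k ≤ y × y < x ⊕ suc k
  floor zero    x≤y y<x = contradiction x≤y (<⇒≱ (subst (_ <_) (⊕-identityʳ _) y<x))
  floor (suc l) {x} {y} x≤y y<x with y <? x ⊕ l
  ... | yes p = let k , k<l , q = floor l x≤y p in k , ℕ.m<n⇒m<1+n k<l , q
  ... | no ¬p = l , ℕ.≤-refl , ≮⇒≥ ¬p , y<x

  infix 4 _≲[_]_
  -- The flag tells whether the bound may be attained, so that open and closed endpoints share one
  -- proof. Refuting a bound reverses it and flips the flag, see `≴⇒`.
  _≲[_]_ : R → Bool → R → Set
  x ≲[ true  ] y = x ≤ y
  x ≲[ false ] y = x < y

  ≲⇒≤ : ∀ c {x y} → x ≲[ c ] y → x ≤ y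
  ≲⇒≤ true  p = p
  ≲⇒≤ false p = inj₁ p

  <⇒≲ : ∀ c {x y} → x < y → x ≲[ c ] y
  <⇒≲ true  p = inj₁ p
  <⇒≲ false p = p

  _≲?[_]_ : ∀ x c y → Dec (x ≲[ c ] y)
  x ≲?[ true  ] y = x ≤? y
  x ≲?[ false ] y = x <? y

  ≤-≲-trans : ∀ c {x y z} → x ≤ y → y ≲[ c ] z → x ≲[ c ] z
  ≤-≲-trans true  = ≤-trans
  ≤-≲-trans false = ≤-<-trans

  ≲-≤-trans : ∀ c {x y z} → x ≲[ c ] y → y ≤ z → x ≲[ c ] z
  ≲-≤-trans true  = ≤-trans
  ≲-≤-trans false = <-≤-trans

  ≴⇒ : ∀ c {x y} → ¬ (x ≲[ c ] y) → y ≲[ not c ] x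
  ≴⇒ true  = ≰⇒>
  ≴⇒ false = ≮⇒≥

  ⊕-mono-≲ : ∀ c {x y} n → x ≲[ c ] y → x ⊕ n ≲[ c ] y ⊕ n
  ⊕-mono-≲ true  = ⊕-mono-≤
  ⊕-mono-≲ false = ⊕-mono-<

  -- x ∈ y + I, phrased without subtraction.
  Upto : Maybe ℕ → Bool → R → R → Set
  Upto nothing  c y x = ⊤
  Upto (just h) c y x = x ≲[ c ] y ⊕ h

  In : Interval → R → R → Set
  In (interval l lc hi hc) y x = (y ⊕ l ≲[ lc ] x) × Upto hi hc y x

  private
    cancel : ∀ x y → (x + - y) + y ≡ x
    cancel x y = trans (+-assoc _ _ _) (trans (cong (x +_) (-‿inverseˡ y)) (+-identityʳ x))

    cancel′ : ∀ x y → (x + y) + - x ≡ y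
    cancel′ x y = trans (cong (_+ - x) (+-comm x y))
        (trans (+-assoc _ _ _) (trans (cong (y +_) (-‿inverseʳ x)) (+-identityʳ y)))

    +-mono-≲ : ∀ c {x y} z → x ≲[ c ] y → x + z ≲[ c ] y + z
    +-mono-≲ true  z (inj₁ p) = inj₁ (+-mono-< z p)
    +-mono-≲ true  z (inj₂ p) = inj₂ (cong (_+ z) p)
    +-mono-≲ false z p = +-mono-< z p

  diff≳⇒ : ∀ c {x y} n → fromℕ n ≲[ c ] x + - y → y ⊕ n ≲[ c ] x
  diff≳⇒ c {x} {y} n p = subst₂ (_≲[ c ]_) (+-comm _ _) (cancel x y) (+-mono-≲ c y p)

  diff≲⇒ : ∀ c {x y} n → x + - y ≲[ c ] fromℕ n → x ≲[ c ] y ⊕ n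
  diff≲⇒ c {x} {y} n p = subst₂ (_≲[ c ]_) (cancel x y) (+-comm _ _) (+-mono-≲ c y p)

  diff≳⇐ : ∀ c {x y} n → y ⊕ n ≲[ c ] x → fromℕ n ≲[ c ] x + - y
  diff≳⇐ c {x} {y} n p = subst (_≲[ c ] x + - y) (cancel′ y (fromℕ n)) (+-mono-≲ c (- y) p)

  diff≲⇐ : ∀ c {x y} n → x ≲[ c ] y ⊕ n → x + - y ≲[ c ] fromℕ n
  diff≲⇐ c {x} {y} n p = subst (x + - y ≲[ c ]_) (cancel′ y (fromℕ n)) (+-mono-≲ c (- y) p)

  ∈I⇒In : ∀ I {x y} → (x + - y) ∈I I → In I y x
  ∈I⇒In (interval l true  nothing  hc)    (p , q) = diff≳⇒ true l p , q
  ∈I⇒In (interval l false nothing  hc)    (p , q) = diff≳⇒ false l p , q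
  ∈I⇒In (interval l true  (just h) true)  (p , q) = diff≳⇒ true l p , diff≲⇒ true h q
  ∈I⇒In (interval l false (just h) true)  (p , q) = diff≳⇒ false l p , diff≲⇒ true h q
  ∈I⇒In (interval l true  (just h) false) (p , q) = diff≳⇒ true l p , diff≲⇒ false h q
  ∈I⇒In (interval l false (just h) false) (p , q) = diff≳⇒ false l p , diff≲⇒ false h q

  In⇒∈I : ∀ I {x y} → In I y x → (x + - y) ∈I I
  In⇒∈I (interval l true  nothing  hc)    (p , q) = diff≳⇐ true l p , q
  In⇒∈I (interval l false nothing  hc)    (p , q) = diff≳⇐ false l p , q
  In⇒∈I (interval l true  (just h) true)  (p , q) = diff≳⇐ true l p , diff≲⇐ true h q
  In⇒∈I (interval l false (just h) true)  (p , q) = diff≳⇐ false l p , diff≲⇐ true h q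
  In⇒∈I (interval l true  (just h) false) (p , q) = diff≳⇐ true l p , diff≲⇐ false h q
  In⇒∈I (interval l false (just h) false) (p , q) = diff≳⇐ false l p , diff≲⇐ false h q

  Upto? : ∀ hi c y x → Dec (Upto hi c y x)
  Upto? nothing  c y x = yes _
  Upto? (just h) c y x = x ≲?[ c ] (y ⊕ h)

-- The future formulas that constrain the new letters.

exactly from : ℕ → Interval
exactly c = interval c true (just c) true
from c    = interval c true nothing true

closed rightOpen : ℕ → ℕ → Interval
closed    a b = interval a true (just b) true
rightOpen a b = interval a true (just b) false

module _ {A : Set} where

  infixr 3 _⇒_
  infixr 5 _⋎_

  bot : Form A
  bot = ¬' tt

  _⇒_ _⋎_ : Form A → Form A → Form A
  φ ⇒ ψ = ¬' (φ ∧ ¬' ψ)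
  φ ⋎ ψ = ¬' (¬' φ ∧ ¬' ψ)

  const : Bool → Form A
  const c = if c then tt else bot

  F[_] : Interval → Form A → Form A
  F[ I ] φ = U[ I ] tt φ

  □ : Form A → Form A
  □ φ = φ ∧ ¬' (F[ from 0 ] (¬' φ))

  ⋀< : ℕ → (ℕ → Form A) → Form A
  ⋀< zero    f = tt
  ⋀< (suc n) f = f n ∧ ⋀< n f

  infixr 3 _⇒ᶠ_
  _⇒ᶠ_ : ∀ {φ ψ : Form A} → FutureOnly φ → FutureOnly ψ → FutureOnly (φ ⇒ ψ)
  p ⇒ᶠ q = ¬' (p ∧ ¬' q)

  infixr 5 _⋎ᶠ_
  _⋎ᶠ_ : ∀ {φ ψ : Form A} → FutureOnly φ → FutureOnly ψ → FutureOnly (φ ⋎ ψ)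
  p ⋎ᶠ q = ¬' (¬' p ∧ ¬' q)

  constᶠ : ∀ c → FutureOnly (const c)
  constᶠ true  = tt
  constᶠ false = ¬' tt

  F[_]ᶠ : ∀ I {φ : Form A} → FutureOnly φ → FutureOnly (F[ I ] φ)
  F[ I ]ᶠ p = U[ I ] tt p

  □ᶠ : ∀ {φ : Form A} → FutureOnly φ → FutureOnly (□ φ)
  □ᶠ p = p ∧ ¬' (F[ from 0 ]ᶠ (¬' p))

  ⋀<ᶠ : ∀ n {f : ℕ → Form A} → (∀ k → FutureOnly (f k)) → FutureOnly (⋀< n f)
  ⋀<ᶠ zero    p = tt
  ⋀<ᶠ (suc n) p = p n ∧ ⋀<ᶠ n p

⋁ : ∀ {A} m → (Fin m → Form A) → Form A
⋁ zero    f = bot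
⋁ (suc m) f = f zero ⋎ ⋁ m (f ∘ suc)

⋁ᶠ : ∀ {A} m {f : Fin m → Form A} → (∀ x → FutureOnly (f x)) → FutureOnly (⋁ m f)
⋁ᶠ zero    p = ¬' tt
⋁ᶠ (suc m) p = p zero ⋎ᶠ ⋁ᶠ m (p ∘ suc)

-- Two translates x + I and y + I with x < y have a connected union iff y ∈ x + gap I.
gap : Interval → Interval
gap (interval l lc hi hc) = interval 0 false (Maybe.map (ℕ._∸ l) hi) (lc or hc)

isZero : ℕ → Bool
isZero zero    = true
isZero (suc _) = false

module Constraints {A : Set} (act β γ w a b e : Form A) where

  ŵ : Form A
  ŵ = act ∧ w

  -- From here on, ŵ may only hold once b has occurred; the flags tell whether
  -- an occurrence here, respectively at the position of ŵ itself, counts.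
  kill : Bool → Bool → Form A
  kill c d = ¬' (¬' (const c ∧ b) ∧ U[ from 0 ] (¬' b) (ŵ ∧ ¬' (const d ∧ b)))

  soon : ℕ → Form A
  soon l = b ⋎ F[ rightOpen 0 l ] b

  -- As `U` looks strictly into the future, a source at distance 0, the position itself, needs the
  -- separate disjunct, which is switched on for `k = 0` only.
  window : ℕ → ℕ → Form A
  window l k = F[ rightOpen (l ℕ.+ k) (l ℕ.+ suc k) ] b
             ⇒ ((const (isZero k) ∧ a) ⋎ F[ rightOpen k (suc k) ] a)

  marks : ℕ → Form A
  -- With delay 0 a mark sits on its own source: there is nothing to trace back, and marks may be
  -- arbitrarily dense.
  marks zero      = b ⇒ γ
  marks l@(suc _) = (BP ⇒ ¬' (soon l))
                  -- `U` with `bot` on its left is the next operator. A mark less than `l` after the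
                  -- position that closes a gap longer than `l` would have its source inside the
                  -- gap.
                  ∧ (¬' (F[ closed 0 l ] tt) ⇒ ¬' (U[ from 0 ] bot (soon l)))
                  ∧ (a ⇒ γ ∧ ¬' (F[ rightOpen 0 l ] (¬' β)))
                  ∧ (a ⇒ F[ exactly l ] b)
                  ∧ (b ⇒ ¬' (F[ rightOpen 0 1 ] b))
                  ∧ ⋀< l (window l)

  ends : Interval → Form A
  ends (interval l lc nothing  hc) = tt
  ends I@(interval l lc (just u) hc) =
      -- With an open upper end the end mark is itself outside the component that it closes, so `ŵ`
      -- is refused there too.
      (e ⇒ kill true lc ∧ (const hc ⋎ ¬' ŵ))
    -- An end mark is demanded only if the word lasts long enough to contain it. The condition
    -- leaves `β` out: where a failure of `β` separates two occurrences of `γ`, the failure itself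
    -- stops `w`.
    ∧ (γ ∧ ¬' (F[ gap I ] γ) ∧ F[ from u ] tt ⇒ F[ exactly u ] e)

  own : Interval → Form A
  own I@(interval l lc hi hc) =
      marks l
    ∧ (γ ⇒ ¬' (U[ I ] β (act ∧ ¬' w)))
    ∧ (BP ⇒ ¬' ŵ ∧ kill true lc)
    -- Since looks strictly into the past, so `β` may fail at the source. A mark at the failing
    -- position counts exactly if `l` is 0, when mark and source coincide; otherwise its source lies
    -- earlier and its stretch is broken here.
    ∧ (¬' β ⇒ kill (isZero l) lc)
    ∧ ends I

  module _ (actᶠ : FutureOnly act) (βᶠ : FutureOnly β) (γᶠ : FutureOnly γ) (wᶠ : FutureOnly w)
           (aᶠ : FutureOnly a) (bᶠ : FutureOnly b) (eᶠ : FutureOnly e) where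

    killᶠ : ∀ c d → FutureOnly (kill c d)
    killᶠ c d = ¬' (¬' (constᶠ c ∧ bᶠ) ∧ U[ _ ] (¬' bᶠ) ((actᶠ ∧ wᶠ) ∧ ¬' (constᶠ d ∧ bᶠ)))

    soonᶠ : ∀ l → FutureOnly (soon l)
    soonᶠ l = bᶠ ⋎ᶠ F[ _ ]ᶠ bᶠ

    marksᶠ : ∀ l → FutureOnly (marks l)
    marksᶠ zero      = bᶠ ⇒ᶠ γᶠ
    marksᶠ l@(suc _) = (BP ⇒ᶠ ¬' (soonᶠ l))
                     ∧ (¬' (F[ _ ]ᶠ tt) ⇒ᶠ ¬' (U[ _ ] (¬' tt) (soonᶠ l)))
                     ∧ (aᶠ ⇒ᶠ γᶠ ∧ ¬' (F[ _ ]ᶠ (¬' βᶠ)))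
                     ∧ (aᶠ ⇒ᶠ F[ _ ]ᶠ bᶠ)
                     ∧ (bᶠ ⇒ᶠ ¬' (F[ _ ]ᶠ bᶠ))
                     ∧ ⋀<ᶠ l λ k → F[ _ ]ᶠ bᶠ ⇒ᶠ ((constᶠ (isZero k) ∧ aᶠ) ⋎ᶠ F[ _ ]ᶠ aᶠ)

    endsᶠ : ∀ I → FutureOnly (ends I)
    endsᶠ (interval l lc nothing  hc) = tt
    endsᶠ (interval l lc (just u) hc) =
        (eᶠ ⇒ᶠ killᶠ true lc ∧ (constᶠ hc ⋎ᶠ ¬' (actᶠ ∧ wᶠ)))
      ∧ (γᶠ ∧ ¬' (F[ _ ]ᶠ γᶠ) ∧ F[ _ ]ᶠ tt ⇒ᶠ F[ _ ]ᶠ eᶠ)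

    ownᶠ : ∀ I → FutureOnly (own I)
    ownᶠ I@(interval l lc hi hc) =
        marksᶠ l
      ∧ (γᶠ ⇒ᶠ ¬' (U[ _ ] βᶠ (actᶠ ∧ ¬' wᶠ)))
      ∧ (BP ⇒ᶠ ¬' (actᶠ ∧ wᶠ) ∧ killᶠ true lc)
      ∧ (¬' βᶠ ⇒ᶠ killᶠ (isZero l) lc)
      ∧ endsᶠ I

-- Finite words: decidable satisfaction, connectives, order of positions.

last-such : ∀ {m} {P : Fin m → Set} → (∀ i → Dec (P i)) → ∃ P →
            ∃ λ j → P j × (∀ k → P k → k Fin.≤ j)
last-such {suc m} {P} P? (i , Pi) with Fin.any? (λ j → P? (suc j))
... | yes ∃P = let j , Pj , max = last-such (λ j → P? (suc j)) ∃P
               in suc j , Pj , λ { zero _ → z≤n ; (suc k) Pk → s≤s (max k Pk) }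
... | no ∄P with i
...   | zero  = zero , Pi , λ { zero _ → z≤n ; (suc k) Pk → contradiction (k , Pk) ∄P }
...   | suc j = contradiction (j , Pi) ∄P

next : ∀ {m} {i j : Fin m} → i Fin.< j → ∃ λ k → toℕ k ≡ suc (toℕ i)
next {i = i} {j} i<j = Fin.fromℕ< i+1<m , Fin.toℕ-fromℕ< i+1<m
  where i+1<m = ℕ.≤-<-trans i<j (Fin.toℕ<n j)

module Words (ℝ : RealLine) where
  open RealLine ℝ using (_<_)
  open Semantics ℝ renaming (_≤_ to infix 4 _≤_)
  open Line ℝ

  Sorted : ∀ {n} → Word n → Set
  Sorted ρ = Linked _<_ (times ρ)

  In? : ∀ I y x → Dec (In I y x)
  In? (interval l lc hi hc) y x = ((y ⊕ l) ≲?[ lc ] x) ×-dec Upto? hi hc y x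

  -- Words are finite and times are comparable, which makes satisfaction decidable. This stands in
  -- for excluded middle: `⇒`, `⋎` and `□`, all encoded by negation, can be read back, and a last
  -- position with a given property can be chosen.
  Sat? : ∀ {n} (ρ : Word n) i φ → Dec (Sat ρ i φ)
  Sat? ρ i (atom a) = a Subset.∈? lab ρ i
  Sat? ρ i BP = toℕ i ℕ.≟ 0
  Sat? ρ i EP = suc (toℕ i) ℕ.≟ length ρ
  Sat? ρ i tt = yes _
  Sat? ρ i (φ ∧ ψ) = Sat? ρ i φ ×-dec Sat? ρ i ψ
  Sat? ρ i (¬' φ) = ¬? (Sat? ρ i φ)
  Sat? ρ i (U[ I ] φ ψ) = Fin.any? λ j → (i Fin.<? j) ×-dec Sat? ρ j ψ
    ×-dec map′ (In⇒∈I I) (∈I⇒In I) (In? I (time ρ i) (time ρ j))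
    ×-dec Fin.all? λ k → (i Fin.<? k) →-dec (k Fin.<? j) →-dec Sat? ρ k φ
  Sat? ρ i (S[ I ] φ ψ) = Fin.any? λ j → (j Fin.<? i) ×-dec Sat? ρ j ψ
    ×-dec map′ (In⇒∈I I) (∈I⇒In I) (In? I (time ρ j) (time ρ i))
    ×-dec Fin.all? λ k → (j Fin.<? k) →-dec (k Fin.<? i) →-dec Sat? ρ k φ

  module Logic {n} (ρ : Word n) where

    ⇒-elim : ∀ {i} φ ψ → Sat ρ i (φ ⇒ ψ) → Sat ρ i φ → Sat ρ i ψ
    ⇒-elim {i} φ ψ h p = decidable-stable (Sat? ρ i ψ) λ ¬q → h (p , ¬q)

    ⇒-intro : ∀ {i} φ ψ → (Sat ρ i φ → Sat ρ i ψ) → Sat ρ i (φ ⇒ ψ)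
    ⇒-intro φ ψ f (p , ¬q) = ¬q (f p)

    ⋎-elim : ∀ {i} φ ψ → Sat ρ i (φ ⋎ ψ) → Sat ρ i φ ⊎ Sat ρ i ψ
    ⋎-elim {i} φ ψ h with Sat? ρ i φ | Sat? ρ i ψ
    ... | yes p | _     = inj₁ p
    ... | no _  | yes q = inj₂ q
    ... | no ¬p | no ¬q = contradiction (¬p , ¬q) h

    ⋎-intro : ∀ {i} φ ψ → Sat ρ i φ ⊎ Sat ρ i ψ → Sat ρ i (φ ⋎ ψ)
    ⋎-intro φ ψ (inj₁ p) (¬p , _) = ¬p p
    ⋎-intro φ ψ (inj₂ q) (_ , ¬q) = ¬q q

    F-intro : ∀ {i j} I φ → i Fin.< j → In I (time ρ i) (time ρ j) → Sat ρ j φ → Sat ρ i (F[ I ] φ)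
    F-intro I φ i<j d p = _ , i<j , p , In⇒∈I I d , _

    F-elim : ∀ {i} I φ → Sat ρ i (F[ I ] φ) → ∃ λ j → i Fin.< j × In I (time ρ i) (time ρ j) × Sat ρ j φ
    F-elim I φ (j , i<j , p , d , _) = j , i<j , ∈I⇒In I d , p

    ⋀<-elim : ∀ {i} n f → Sat ρ i (⋀< n f) → ∀ {k} → k ℕ.< n → Sat ρ i (f k)
    ⋀<-elim {i} (suc n) f (p , ps) {k} (s≤s k≤n) with k ℕ.≟ n
    ... | yes refl = p
    ... | no k≢n   = ⋀<-elim n f ps (ℕ.≤∧≢⇒< k≤n k≢n)

    ⋀<-intro : ∀ {i} n f → (∀ k → k ℕ.< n → Sat ρ i (f k)) → Sat ρ i (⋀< n f)
    ⋀<-intro zero    f p = _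
    ⋀<-intro (suc n) f p = p n ℕ.≤-refl , ⋀<-intro n f λ k k<n → p k (ℕ.m<n⇒m<1+n k<n)

    ⋁-intro : ∀ {i} m g x → Sat ρ i (g x) → Sat ρ i (⋁ m g)
    ⋁-intro {i} (suc m) g zero    h = ⋎-intro {i = i} (g zero) (⋁ m (g ∘ suc)) (inj₁ h)
    ⋁-intro {i} (suc m) g (suc x) h = ⋎-intro {i = i} (g zero) (⋁ m (g ∘ suc)) (inj₂ (⋁-intro m (g ∘ suc) x h))

    ⋁-elim : ∀ {i} m g → Sat ρ i (⋁ m g) → ∃ λ x → Sat ρ i (g x)
    ⋁-elim zero    g h = contradiction _ h
    ⋁-elim {i} (suc m) g h with ⋎-elim {i = i} (g zero) (⋁ m (g ∘ suc)) h
    ... | inj₁ q = zero , q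
    ... | inj₂ q = let x , r = ⋁-elim m (g ∘ suc) q in suc x , r

  module Order {n} (ρ : Word n) (sorted : Sorted ρ) where

    τ : Fin (length ρ) → R
    τ = time ρ

    time-mono-< : ∀ {i j} → i Fin.< j → τ i < τ j
    time-mono-< {i} {j} = go ρ (Linked⇒AllPairs <-trans sorted) i j
      where
      lookupTimes : ∀ {x} (σ : Word n) → All (x <_) (times σ) → ∀ j → x < time σ j
      lookupTimes (_ ∷ σ) (p ∷ ps) zero    = p
      lookupTimes (_ ∷ σ) (p ∷ ps) (suc j) = lookupTimes σ ps j
      go : (σ : Word n) → AllPairs _<_ (times σ) → ∀ i j → i Fin.< j → time σ i < time σ j
      go (_ ∷ σ) (p ∷ ps) zero    (suc j) _         = lookupTimes σ p j
      go (_ ∷ σ) (p ∷ ps) (suc i) (suc j) (s≤s i<j) = go σ ps i j i<j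

    time-cancel-< : ∀ {i j} → τ i < τ j → i Fin.< j
    time-cancel-< {i} {j} p with Fin.<-cmp i j
    ... | tri< i<j _ _ = i<j
    ... | tri≈ _ refl _ = contradiction p (<-irrefl refl)
    ... | tri> _ _ j<i = contradiction (inj₁ (time-mono-< j<i)) (<⇒≱ p)

    time-mono-≤ : ∀ {i j} → i Fin.≤ j → τ i ≤ τ j
    time-mono-≤ i≤j = ≮⇒≥ λ p → ℕ.≤⇒≯ i≤j (time-cancel-< p)

    time-cancel-≤ : ∀ {i j} → τ i ≤ τ j → i Fin.≤ j
    time-cancel-≤ p = ℕ.≮⇒≥ λ j<i → <⇒≱ (time-mono-< j<i) p

    time-injective : ∀ {i j} → τ i ≡ τ j → i ≡ j
    time-injective p = Fin.≤-antisym (time-cancel-≤ (inj₂ p)) (time-cancel-≤ (inj₂ (sym p)))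

    In-from0 : ∀ {i j} → i Fin.< j → In (from 0) (τ i) (τ j)
    In-from0 i<j = ≤-trans (inj₂ (⊕-identityʳ _)) (inj₁ (time-mono-< i<j)) , _

    In-rightOpen0 : ∀ {i j} l → i Fin.< j → τ j < τ i ⊕ l → In (rightOpen 0 l) (τ i) (τ j)
    In-rightOpen0 l i<j p = proj₁ (In-from0 i<j) , p

-- Soundness of the constraints: a letter `w` has a witness in the past.

first : ∀ {m} → Fin m → ∃ λ (i : Fin m) → toℕ i ≡ 0 × ((j : Fin m) → i Fin.≤ j)
first {suc m} _ = zero , refl , λ _ → z≤n

infix 4 _≼[_]_
_≼[_]_ : ∀ {m} → Fin m → Bool → Fin m → Set
i ≼[ true  ] j = i Fin.≤ j
i ≼[ false ] j = i Fin.< j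

<⇒≼ : ∀ c {m} {i j : Fin m} → i Fin.< j → i ≼[ c ] j
<⇒≼ true  = ℕ.<⇒≤
<⇒≼ false i<j = i<j

≼⇒≤ : ∀ c {m} {i j : Fin m} → i ≼[ c ] j → i Fin.≤ j
≼⇒≤ true  i≤j = i≤j
≼⇒≤ false = ℕ.<⇒≤

_≼?[_]_ : ∀ {m} (i : Fin m) c j → Dec (i ≼[ c ] j)
i ≼?[ true  ] j = i Fin.≤? j
i ≼?[ false ] j = i Fin.<? j

-- The lower end of the interval is excluded if it is 0, as β S γ looks strictly into the past.
Normal : Interval → Set
Normal (interval l lc hi hc) = lc ≡ true → 0 ℕ.< l

Proper : Interval → Set
Proper (interval l lc nothing  hc) = ⊤
Proper (interval l lc (just u) hc) = l ℕ.< u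

module Soundness (ℝ : RealLine) {K : ℕ} (ρ : Semantics.Word ℝ K) (sorted : Words.Sorted ℝ ρ)
                 (act β γ w a b e : Form (Fin K)) where
  open RealLine ℝ using (_<_)
  open Semantics ℝ renaming (_≤_ to infix 4 _≤_)
  open Line ℝ
  open Words ℝ
  open Logic ρ
  open Order ρ sorted
  open Constraints act β γ w a b e

  time-mono-≼ : ∀ c {i j} → i ≼[ c ] j → τ i ≲[ c ] τ j
  time-mono-≼ true  = time-mono-≤
  time-mono-≼ false = time-mono-<

  kill-elim : ∀ c d {r i} → Sat ρ r (kill c d) → r Fin.< i → Sat ρ i ŵ →
              ∃ λ p → Sat ρ p b × r ≼[ c ] p × p ≼[ d ] i
  kill-elim c d {r} {i} k r<i wi with Sat? ρ r (const c ∧ b)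
  ... | yes (tc , br) = r , br , lemma c tc , <⇒≼ d r<i
    where lemma : ∀ c → Sat ρ r (const c) → r ≼[ c ] r
          lemma true  _ = ℕ.≤-refl
          lemma false h = contradiction _ h
  ... | no ¬cb with Sat? ρ i (const d ∧ b)
  ...   | yes (td , bi) = i , bi , <⇒≼ c r<i , lemma d td
    where lemma : ∀ c → Sat ρ i (const c) → i ≼[ c ] i
          lemma true  _ = ℕ.≤-refl
          lemma false h = contradiction _ h
  ...   | no ¬db with Fin.any? (λ p → Sat? ρ p b ×-dec (r Fin.<? p) ×-dec (p Fin.<? i))
  ...     | yes (p , bp , r<p , p<i) = p , bp , <⇒≼ c r<p , <⇒≼ d p<i
  ...     | no ∄p = contradiction
              (¬cb , i , r<i , (wi , ¬db) , In⇒∈I (from 0) (In-from0 r<i) , λ k r<k k<i bk → ∄p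
                  (k , bk , r<k , k<i)) k

  soon-intro : ∀ l {q p} → q Fin.≤ p → τ p < τ q ⊕ l → Sat ρ p b → Sat ρ q (soon l)
  soon-intro l {q} {p} q≤p p<q+l bp with q Fin.≟ p
  ... | yes refl = ⋎-intro {i = q} b (F[ rightOpen 0 l ] b) (inj₁ bp)
  ... | no q≢p   = ⋎-intro {i = q} b (F[ rightOpen 0 l ] b)
                     (inj₂ (F-intro (rightOpen 0 l) b q<p (In-rightOpen0 l q<p p<q+l) bp))
    where q<p = Fin.≤∧≢⇒< q≤p q≢p

  -- The stretch of `β` ends just before the mark; failures of `β` at the mark or later are left to
  -- `kill`.
  Source : ℕ → Fin (length ρ) → Fin (length ρ) → Set
  Source l p s = Sat ρ s γ × τ s ⊕ l ≡ τ p × (∀ r → s Fin.< r → τ r < τ s ⊕ l → Sat ρ r β)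

  -- The last position q with τ q + l ≤ τ p sees p in one of its unit windows at
  -- distance l + k, hence a source at distance k; as b occurs at most once per
  -- unit of time, the mark of this source is p.
  module _ (k : ℕ) (m : ∀ q → Sat ρ q (marks (suc k))) where
    private l = suc k

    mark-sparse : ∀ {x y} → Sat ρ x b → Sat ρ y b → x Fin.< y → ¬ (τ y < τ x ⊕ 1)
    mark-sparse {x} bx by x<y y<x+1 with m x
    ... | _ , _ , _ , _ , mx , _ =
      ⇒-elim b (¬' (F[ rightOpen 0 1 ] b)) mx bx (F-intro {i = x} (rightOpen 0 1) b x<y
          (In-rightOpen0 1 x<y y<x+1) by)

    source-mark : ∀ {s} → Sat ρ s a → ∃ λ p → Sat ρ p b × Source l p s
    source-mark {s} as with m s
    ... | _ , _ , run , mark , _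
      with ⇒-elim a (γ ∧ ¬' (F[ rightOpen 0 l ] (¬' β))) run as
         | F-elim {i = s} (exactly l) b (⇒-elim a (F[ exactly l ] b) mark as)
    ... | γs , ¬¬β | p , s<p , (lo , hi) , bp = p , bp , γs , ≤-antisym lo hi , λ r s<r r<s+l →
      decidable-stable (Sat? ρ r β) λ ¬βr → ¬¬β (F-intro {i = s} (rightOpen 0 l) (¬' β) s<r
          (In-rightOpen0 l s<r r<s+l) ¬βr)

    self-source : ∀ {q} j → Sat ρ q (const (isZero j) ∧ a) →
                  ∃ λ s → Sat ρ s a × τ q ⊕ j ≤ τ s × τ s < τ q ⊕ suc j
    self-source {q} zero (_ , aq) = q , aq , inj₂ (⊕-identityʳ _) , x<x⊕n {n = 1} (s≤s z≤n)
    self-source (suc j)  (h , _)  = contradiction _ h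

    window-source : ∀ {q p j} → j ℕ.< l → Sat ρ p b → τ q ⊕ l ⊕ j ≤ τ p → τ p < τ q ⊕ l ⊕ suc j →
                    ∃ λ s → Sat ρ s a × τ q ⊕ j ≤ τ s × τ s < τ q ⊕ suc j
    window-source {q} {p} {j} j<l bp lo hi with m q
    ... | _ , _ , _ , _ , _ , ws
      with ⋎-elim {i = q} (const (isZero j) ∧ a) (F[ rightOpen j (suc j) ] a)
             (⇒-elim (F[ rightOpen (l ℕ.+ j) (l ℕ.+ suc j) ] b)
                 ((const (isZero j) ∧ a) ⋎ F[ rightOpen j (suc j) ] a) (⋀<-elim l (window l) ws j<l)
               (F-intro {i = q} (rightOpen (l ℕ.+ j) (l ℕ.+ suc j)) b q<p
                 (subst (_≤ τ p) (⊕-⊕ _ l j) lo , subst (τ p <_) (⊕-⊕ _ l (suc j)) hi) bp))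
      where
      q<p : q Fin.< p
      q<p = time-cancel-< (<-≤-trans (x<x⊕n {n = l} (s≤s z≤n)) (≤-trans (x≤x⊕n j) lo))
    ... | inj₁ h = self-source j h
    ... | inj₂ h = let s , _ , (q+j≤s , s<) , as = F-elim {i = q} (rightOpen j (suc j)) a h in s , as , q+j≤s , s<

    same-window : ∀ {x p p′} j → Sat ρ p b → Sat ρ p′ b → x ⊕ j ≤ τ p → τ p < x ⊕ suc j →
                  x ⊕ j ≤ τ p′ → τ p′ < x ⊕ suc j → p ≡ p′
    same-window {x} {p} {p′} j bp bp′ lo hi lo′ hi′ = decide (Fin.<-cmp p p′)
      where
      +1 : x ⊕ suc j ≡ x ⊕ j ⊕ 1
      +1 = trans (cong (x ⊕_) (ℕ.+-comm 1 j)) (sym (⊕-⊕ x j 1))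
      decide : _ → p ≡ p′
      decide (tri< p<p′ _ _) = contradiction (<-≤-trans hi′ (≤-trans (inj₂ +1) (⊕-mono-≤ 1 lo)))
          (mark-sparse bp bp′ p<p′)
      decide (tri≈ _ eq _)   = eq
      decide (tri> _ _ p′<p) = contradiction (<-≤-trans hi (≤-trans (inj₂ +1) (⊕-mono-≤ 1 lo′)))
          (mark-sparse bp′ bp p′<p)

    near-source : ∀ {q p} → Sat ρ p b → τ q ⊕ l ≤ τ p → τ p < τ q ⊕ l ⊕ l → ∃ (Source l p)
    near-source {q} {p} bp q+l≤p p<q+l+l with floor l q+l≤p p<q+l+l
    ... | j , j<l , lo , hi with window-source j<l bp lo hi
    ... | s , as , q+j≤s , s<q+j+1 with source-mark as
    ... | p′ , bp′ , src@(_ , s+l≡p′ , _) = s , subst (λ x → Source l x s) (sym p≡p′) src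
      where
      shift : ∀ j → τ q ⊕ j ⊕ l ≡ τ q ⊕ l ⊕ j
      shift j = trans (⊕-⊕ _ j l) (trans (cong (τ q ⊕_) (ℕ.+-comm j l)) (sym (⊕-⊕ _ l j)))
      p≡p′ : p ≡ p′
      -- Adding `l` moves the unit window in which the source was found onto the one that contains
      -- `p`.
      p≡p′ = same-window j bp bp′ lo hi (subst₂ _≤_ (shift j) s+l≡p′ (⊕-mono-≤ l q+j≤s))
                                        (subst₂ _<_ s+l≡p′ (shift (suc j)) (⊕-mono-< l s<q+j+1))

    gap-unmarked : ∀ {q q′ p} → q Fin.< q′ → (∀ {r} → q Fin.< r → q′ Fin.≤ r) → τ q ⊕ l < τ q′ →
                   q′ Fin.≤ p → τ p < τ q′ ⊕ l → ¬ Sat ρ p b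
    gap-unmarked {q} {q′} q<q′ q′≤ far q′≤p p<q′+l bp with m q
    ... | _ , mq , _ = ⇒-elim (¬' (F[ closed 0 l ] tt)) (¬' (U[ from 0 ] bot (soon l))) mq no-near
      (q′ , q<q′ , soon-intro l q′≤p p<q′+l bp , In⇒∈I (from 0) (In-from0 q<q′) ,
       λ k q<k k<q′ → contradiction (q′≤ q<k) (ℕ.<⇒≱ k<q′))
      where
      no-near : ¬ Sat ρ q (F[ closed 0 l ] tt)
      no-near h = let r , q<r , (_ , r≤) , _ = F-elim {i = q} (closed 0 l) tt h in
                  <⇒≱ far (≤-trans (time-mono-≤ (q′≤ q<r)) r≤)

    last-source : ∀ {q p} → Sat ρ p b → τ q ⊕ l ≤ τ p → (∀ r → τ r ⊕ l ≤ τ p → r Fin.≤ q) → ∃ (Source l p)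
    last-source {q} {p} bp q+l≤p q-last
      with next (time-cancel-< (<-≤-trans (x<x⊕n {n = l} (s≤s z≤n)) q+l≤p))
    ... | q′ , q′≡ = decide (τ q′ ≤? τ q ⊕ l)
      where
      q<p : q Fin.< p
      q<p = time-cancel-< (<-≤-trans (x<x⊕n {n = l} (s≤s z≤n)) q+l≤p)
      q<q′ : q Fin.< q′
      q<q′ = ℕ.≤-reflexive (sym q′≡)
      q′≤ : ∀ {r} → q Fin.< r → q′ Fin.≤ r
      q′≤ q<r = subst (ℕ._≤ _) (sym q′≡) q<r
      p<q′+l : τ p < τ q′ ⊕ l
      p<q′+l = ≰⇒> λ h → ℕ.<⇒≱ q<q′ (q-last q′ h)
      decide : Dec (τ q′ ≤ τ q ⊕ l) → ∃ (Source l p)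
      -- Maximality of `q` puts `p` before `τ q′ + l`, hence before `τ q + 2l`: this is why `l` unit
      -- windows, starting at distance `l`, are enough.
      decide (yes near) = near-source bp q+l≤p (<-≤-trans p<q′+l (⊕-mono-≤ l near))
      decide (no ¬near) = contradiction bp (gap-unmarked q<q′ q′≤ (≰⇒> ¬near) (q′≤ q<p) p<q′+l)

    mark⇒source : ∀ {p} → Sat ρ p b → ∃ (Source l p)
    mark⇒source {p} bp = decide (Fin.any? λ q → τ q ⊕ l ≤? τ p)
      where
      decide : Dec (∃ λ q → τ q ⊕ l ≤ τ p) → ∃ (Source l p)
      decide (yes ∃q) = let q , q+l≤p , q-last = last-such (λ q → τ q ⊕ l ≤? τ p) ∃q
                        in last-source bp q+l≤p q-last
      decide (no ∄q)  = let z , z≡0 , z≤ = first p in contradiction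
        (soon-intro l (z≤ p) (≰⇒> λ q → ∄q (z , q)) bp) (⇒-elim BP (¬' (soon l)) (proj₁ (m z)) z≡0)

  marks⇒source : ∀ l → (∀ q → Sat ρ q (marks l)) → ∀ {p} → Sat ρ p b → ∃ (Source l p)
  marks⇒source (suc k) m bp = mark⇒source k m bp
  marks⇒source zero m {p} bp =
    p , ⇒-elim b γ (m p) bp , ⊕-identityʳ _ ,
    λ r p<r r<p → contradiction (inj₁ (time-mono-< p<r)) (<⇒≱ (subst (_ <_) (⊕-identityʳ _) r<p))

  -- An end mark at τ j + u forces a mark after it, whose source would be later than j.
  ends⇒upto : ∀ I {i j p s} → Proper I → (∀ q → Sat ρ q (ends I)) → Sat ρ i ŵ →
    let open Interval I in
    (∀ p′ → Sat ρ p′ b → p′ ≼[ loClosed ] i → p′ Fin.≤ p) → τ s ⊕ lo ≡ τ p → s Fin.≤ j →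
    j Fin.< i → Sat ρ j γ → (∀ k → Sat ρ k γ → τ k ⊕ lo ≲[ loClosed ] τ i → k Fin.≤ j) →
    Upto hi hiClosed (τ j) (τ i)
  ends⇒upto (interval l lc nothing hc) _ _ _ _ _ _ _ _ _ = _
  ends⇒upto I@(interval l lc (just u) hc) {i} {j} {p} {s} l<u m wi p-last s+l≡p s≤j j<i γj j-last =
    decide (τ i ≲?[ hc ] (τ j ⊕ u))
    where
    -- Used with `x` the lower end of the translate of `k`, `y` the upper end of that of `j`, and
    -- `z` the time of `i`. Whatever the flags, one of the three steps around the cycle is strict.
    cycle : ∀ lc hc {x y z} → x ≲[ lc or hc ] y → z ≲[ not lc ] x → y ≲[ not hc ] z → ⊥
    cycle true  hc    p q r = <⇒≱ q (≤-trans p (≲⇒≤ (not hc) r))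
    cycle false true  p q r = <⇒≱ r (≤-trans q p)
    cycle false false p q r = <⇒≱ p (≤-trans r q)

    isolated : τ j ⊕ u ≲[ not hc ] τ i → ¬ Sat ρ j (F[ gap I ] γ)
    isolated j+u≲i h with F-elim {i = j} (gap I) γ h
    ... | k , j<k , (_ , k≲) , γk =
      cycle lc hc (subst (τ k ⊕ l ≲[ lc or hc ]_) (⊕-∸ (τ j) (ℕ.<⇒≤ l<u)) (⊕-mono-≲ (lc or hc) l k≲))
        (≴⇒ lc λ q → ℕ.<⇒≱ j<k (j-last k γk q)) j+u≲i

    killed : ∀ {x} → τ x ≡ τ j ⊕ u → ¬ (τ i ≲[ hc ] τ j ⊕ u) → Sat ρ x (kill true lc) → Sat ρ x
        (const hc ⋎ ¬' ŵ) → x Fin.≤ i → ⊥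
    killed {x} x≡j+u ¬h kx sx x≤i with x Fin.≟ i
    ... | yes refl = self hc ¬h sx
      where
      self : ∀ hc → ¬ (τ i ≲[ hc ] τ j ⊕ u) → Sat ρ i (const hc ⋎ ¬' ŵ) → ⊥
      self true  ¬h _ = ¬h (inj₂ x≡j+u)
      self false _  h with ⋎-elim {i = i} bot (¬' ŵ) h
      ... | inj₁ q = q _
      ... | inj₂ q = q wi
    ... | no x≢i with kill-elim true lc kx (Fin.≤∧≢⇒< x≤i x≢i) wi
    ... | p′ , b′ , x≤p′ , p′≼i = <⇒≱ (⊕-cancel-< l (<-≤-trans j+l<j+u j+u≤s+l)) (time-mono-≤ s≤j)
      where
      j+u≤s+l : τ j ⊕ u ≤ τ s ⊕ l
      j+u≤s+l = ≤-trans (inj₂ (sym x≡j+u)) (≤-trans (time-mono-≤ (ℕ.≤-trans x≤p′ (p-last p′ b′ p′≼i)))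
          (inj₂ (sym s+l≡p)))
      j+l<j+u : τ j ⊕ l < τ j ⊕ u
      j+l<j+u = ⊕-monoʳ-< (τ j) l<u

    decide : Dec (τ i ≲[ hc ] τ j ⊕ u) → τ i ≲[ hc ] τ j ⊕ u
    decide (yes h) = h
    decide (no ¬h) with m j
    ... | _ , mj with F-elim {i = j} (exactly u) e (⇒-elim (γ ∧ ¬' (F[ gap I ] γ) ∧ F[ from u ] tt)
        (F[ exactly u ] e) mj
                        (γj , isolated (≴⇒ hc ¬h) , F-intro {i = j} (from u) tt j<i (≲⇒≤ (not hc) (≴⇒ hc ¬h) , _) _))
    ... | x , _ , (lo , hi) , ex with m x
    ... | mx , _ with ⇒-elim e (kill true lc ∧ (const hc ⋎ ¬' ŵ)) mx ex
    ... | kx , sx = contradiction (killed (≤-antisym hi lo) ¬h kx sx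
        (time-cancel-≤ (≤-trans hi (≲⇒≤ (not hc) (≴⇒ hc ¬h))))) λ ()

  Witness : Interval → Fin (length ρ) → Set
  Witness I i = ∃ λ j → j Fin.< i × Sat ρ j γ × In I (τ j) (τ i) × (∀ k → j Fin.< k → k Fin.< i → Sat ρ k β)

  module _ (I : Interval) (normal : Normal I) (proper : Proper I) (m : ∀ q → Sat ρ q (own I))
           {i : Fin (length ρ)} (wi : Sat ρ i ŵ) where
    open Interval I renaming (lo to l; loClosed to lc; hiClosed to hc)

    marked : ∃ λ p → Sat ρ p b × p ≼[ lc ] i
    marked with first i
    ... | z , z≡0 , z≤ with m z
    ... | _ , _ , mz , _ with ⇒-elim BP (¬' ŵ ∧ kill true lc) mz z≡0
    ... | ¬wz , kz with z Fin.≟ i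
    ... | yes refl = contradiction wi ¬wz
    ... | no z≢i   = let p , bp , _ , p≼i = kill-elim true lc kz (Fin.≤∧≢⇒< (z≤ i) z≢i) wi in p , bp , p≼i

    -- A failure of `β` at `r` forces a mark between `r` and `i`. The last mark `p` is not earlier
    -- than this one, which places `r` in the stretch between the source and its mark, where `β` is
    -- guaranteed.
    β-since-source : ∀ {p s} → (∀ p′ → Sat ρ p′ b → p′ ≼[ lc ] i → p′ Fin.≤ p) → Source l p s →
                     ∀ r → s Fin.< r → r Fin.< i → Sat ρ r β
    β-since-source {p} {s} p-last (_ , s+l≡p , run) r s<r r<i = decidable-stable (Sat? ρ r β) absurd
      where
      before : ∀ l → τ s ⊕ l ≡ τ p → ∀ p′ → r ≼[ isZero l ] p′ → p′ Fin.≤ p → τ r < τ s ⊕ l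
      before zero    eq p′ r≤p′ p′≤p = contradiction
        (≤-trans (time-mono-≤ (ℕ.≤-trans r≤p′ p′≤p)) (inj₂ (trans (sym eq) (⊕-identityʳ _)))) (<⇒≱ (time-mono-< s<r))
      before (suc _) eq p′ r<p′ p′≤p = <-≤-trans (time-mono-< (ℕ.<-≤-trans r<p′ p′≤p)) (inj₂ (sym eq))
      absurd : ¬ ¬ Sat ρ r β
      absurd ¬βr with m r
      ... | _ , _ , _ , mr , _ with kill-elim (isZero l) lc (⇒-elim (¬' β) (kill (isZero l) lc) mr ¬βr) r<i wi
      ... | p′ , b′ , r≼p′ , p′≼i = ¬βr (run r s<r (before l s+l≡p p′ r≼p′ (p-last p′ b′ p′≼i)))

    -- The source only starts the component, and `i` may lie far beyond its translate of `I`. The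
    -- witness is instead the last `γ`-position whose translate has begun by `i`: it is not before
    -- the source, so it inherits the stretch of `β`, and the end marks bound its distance from `i`.
    witness-from : ∀ {p s} → Sat ρ p b → p ≼[ lc ] i → (∀ p′ → Sat ρ p′ b → p′ ≼[ lc ] i → p′ Fin.≤ p) →
                   Source l p s → Witness I i
    witness-from {p} {s} bp p≼i p-last src@(γs , s+l≡p , _) =
      pick (last-such (λ j → Sat? ρ j γ ×-dec ((τ j ⊕ l) ≲?[ lc ] τ i)) (s , γs , s+l≲i))
      where
      s+l≲i : τ s ⊕ l ≲[ lc ] τ i
      s+l≲i = ≤-≲-trans lc (inj₂ s+l≡p) (time-mono-≼ lc p≼i)
      strict : ∀ {j} c → lc ≡ c → τ j ⊕ l ≲[ c ] τ i → τ j < τ i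
      strict true  eq h = <-≤-trans (x<x⊕n (normal eq)) h
      strict false eq h = ≤-<-trans (x≤x⊕n l) h
      pick : (∃ λ j → (Sat ρ j γ × τ j ⊕ l ≲[ lc ] τ i) ×
          (∀ k → Sat ρ k γ × τ k ⊕ l ≲[ lc ] τ i → k Fin.≤ j)) → Witness I i
      pick (j , (γj , j+l≲i) , j-last) =
        j , j<i , γj , (j+l≲i , ends⇒upto I proper (λ q → proj₂
            (proj₂ (proj₂ (proj₂ (m q))))) wi p-last s+l≡p s≤j j<i γj j-last′) ,
        λ k j<k k<i → β-since-source p-last src k (ℕ.≤-<-trans s≤j j<k) k<i
        where
        j<i : j Fin.< i
        j<i = time-cancel-< (strict lc refl j+l≲i)
        j-last′ : ∀ k → Sat ρ k γ → τ k ⊕ l ≲[ lc ] τ i → k Fin.≤ j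
        j-last′ k γk h = j-last k (γk , h)
        s≤j : s Fin.≤ j
        s≤j = j-last′ s γs s+l≲i

    own⇒since : Witness I i
    own⇒since with last-such (λ p → Sat? ρ p b ×-dec (p ≼?[ lc ] i)) marked
    ... | p , (bp , p≼i) , p-last with marks⇒source l (λ q → proj₁ (m q)) bp
    ... | s , src = witness-from bp p≼i (λ p′ b′ h → p-last p′ (b′ , h)) src

-- Normal intervals and the translation of formulas.

proper? : ∀ I → Dec (Proper I)
proper? (interval l lc nothing  hc) = yes _
proper? (interval l lc (just u) hc) = l ℕ.<? u

normalise : Interval → Interval
normalise (interval zero      lc hi hc) = interval zero false hi hc
normalise (interval l@(suc _) lc hi hc) = interval l lc hi hc

normalise-normal : ∀ I → Normal (normalise I)
normalise-normal (interval zero    lc hi hc) ()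
normalise-normal (interval (suc l) lc hi hc) _ = s≤s z≤n

normalise-proper : ∀ I → Proper I → Proper (normalise I)
normalise-proper (interval zero    lc nothing  hc) p = p
normalise-proper (interval zero    lc (just u) hc) p = p
normalise-proper (interval (suc l) lc nothing  hc) p = p
normalise-proper (interval (suc l) lc (just u) hc) p = p

size : ∀ {A} → Form A → ℕ
size (atom a)     = 0
size BP           = 0
size EP           = 0
size tt           = 0
size (φ ∧ ψ)      = size φ ℕ.+ size ψ
size (¬' φ)       = size φ
size (U[ I ] φ ψ) = size φ ℕ.+ size ψ
size (S[ I ] φ ψ) = 4 ℕ.+ (size φ ℕ.+ size ψ)

module Translation (n k : ℕ) where

  act : Form (Fin (n ℕ.+ k))
  act = ⋁ n λ x → atom (x ↑ˡ k)

  actᶠ : FutureOnly act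
  actᶠ = ⋁ᶠ n λ x → atom (x ↑ˡ k)

  leftOf : ∀ {A : Set} {m} m′ → (Fin (m ℕ.+ m′) → A) → Fin m → A
  leftOf m′ e x = e (x ↑ˡ m′)

  rightOf : ∀ {A : Set} m {m′} → (Fin (m ℕ.+ m′) → A) → Fin m′ → A
  rightOf m e x = e (m ↑ʳ x)

  -- Until is relativised to action points: added positions are passed over on its left and refused
  -- on its right. The operands of a since survive only in `constraints`.
  translate : (φ : Form (Fin n)) → (Fin (size φ) → Fin (n ℕ.+ k)) → Form (Fin (n ℕ.+ k))
  translate (atom x)     e = atom (x ↑ˡ k)
  translate BP           e = BP
  translate EP           e = EP
  translate tt           e = tt
  translate (φ ∧ ψ)      e = translate φ (leftOf (size ψ) e) ∧ translate ψ (rightOf (size φ) e)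
  translate (¬' φ)       e = ¬' (translate φ e)
  translate (U[ I ] φ ψ) e = U[ I ] (act ⇒ translate φ (leftOf (size ψ) e)) (act ∧ translate ψ (rightOf (size φ) e))
  translate (S[ I ] φ ψ) e = atom (e zero)

  module Letters (β γ : Form (Fin n)) (e : Fin (4 ℕ.+ (size β ℕ.+ size γ)) → Fin (n ℕ.+ k)) where
    eβ : Fin (size β) → Fin (n ℕ.+ k)
    eβ = leftOf (size γ) (rightOf 4 e)

    eγ : Fin (size γ) → Fin (n ℕ.+ k)
    eγ = rightOf (size β) (rightOf 4 e)

    β̂ γ̂ : Form (Fin (n ℕ.+ k))
    β̂ = act ⇒ translate β eβ
    γ̂ = act ∧ translate γ eγ

    open Constraints act β̂ γ̂ (atom (e zero)) (atom (e (suc zero))) (atom (e (suc (suc zero)))) (atom (e (suc (suc (suc zero))))) public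

    -- A non-singular interval that is not `Proper` is empty, so that the since is false everywhere
    -- and its letter is banned.
    define : Interval → Form (Fin (n ℕ.+ k))
    define I = if does (proper? I) then own (normalise I) else ¬' (atom (e zero))

  constraints : (φ : Form (Fin n)) → (Fin (size φ) → Fin (n ℕ.+ k)) → Form (Fin (n ℕ.+ k))
  constraints (atom x)     e = tt
  constraints BP           e = tt
  constraints EP           e = tt
  constraints tt           e = tt
  constraints (φ ∧ ψ)      e = constraints φ (leftOf (size ψ) e) ∧ constraints ψ (rightOf (size φ) e)
  constraints (¬' φ)       e = constraints φ e
  constraints (U[ I ] φ ψ) e = constraints φ (leftOf (size ψ) e) ∧ constraints ψ (rightOf (size φ) e)
  constraints (S[ I ] φ ψ) e = define I ∧ constraints φ eβ ∧ constraints ψ eγ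
    where open Letters φ ψ e

  translateᶠ : ∀ φ e → FutureOnly (translate φ e)
  translateᶠ (atom x)     e = atom (x ↑ˡ k)
  translateᶠ BP           e = BP
  translateᶠ EP           e = EP
  translateᶠ tt           e = tt
  translateᶠ (φ ∧ ψ)      e = translateᶠ φ _ ∧ translateᶠ ψ _
  translateᶠ (¬' φ)       e = ¬' (translateᶠ φ e)
  translateᶠ (U[ I ] φ ψ) e = U[ I ] (actᶠ ⇒ᶠ translateᶠ φ _) (actᶠ ∧ translateᶠ ψ _)
  translateᶠ (S[ I ] φ ψ) e = atom (e zero)

  constraintsᶠ : ∀ φ e → FutureOnly (constraints φ e)
  constraintsᶠ (atom x)     e = tt
  constraintsᶠ BP           e = tt
  constraintsᶠ EP           e = tt
  constraintsᶠ tt           e = tt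
  constraintsᶠ (φ ∧ ψ)      e = constraintsᶠ φ _ ∧ constraintsᶠ ψ _
  constraintsᶠ (¬' φ)       e = constraintsᶠ φ e
  constraintsᶠ (U[ I ] φ ψ) e = constraintsᶠ φ _ ∧ constraintsᶠ ψ _
  constraintsᶠ (S[ I ] φ ψ) e = defineᶠ ∧ constraintsᶠ φ _ ∧ constraintsᶠ ψ _
    where
    open Letters φ ψ e
    defineᶠ : FutureOnly (define I)
    defineᶠ with does (proper? I)
    ... | true  = ownᶠ actᶠ (actᶠ ⇒ᶠ translateᶠ φ _) (actᶠ ∧ translateᶠ ψ _) (atom _) (atom _) (atom _)
        (atom _) (normalise I)
    ... | false = ¬' (atom _)

  -- This lets `BP` and `EP` be translated by themselves: the extreme positions of the word and of
  -- its projection correspond.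
  wellFramed : Form (Fin (n ℕ.+ k))
  wellFramed = (BP ⇒ act) ∧ (EP ⇒ act)

-- Projection, and agreement of a formula with its translation.

lookup-take : ∀ n {k} {A : Set} (v : Vec A (n ℕ.+ k)) x → lookup (take n v) x ≡ lookup v (x ↑ˡ k)
lookup-take (suc n) (y ∷ v) zero    = refl
lookup-take (suc n) (y ∷ v) (suc x) = lookup-take n v x

∈-take⇒ : ∀ n {k} (Y : Subset (n ℕ.+ k)) {x} → x ∈ take n Y → x ↑ˡ k ∈ Y
∈-take⇒ n Y {x} p = Vec.lookup⇒[]= _ Y (trans (sym (lookup-take n Y x)) (Vec.[]=⇒lookup p))

∈-take⇐ : ∀ n {k} (Y : Subset (n ℕ.+ k)) {x} → x ↑ˡ k ∈ Y → x ∈ take n Y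
∈-take⇐ n Y {x} p = Vec.lookup⇒[]= _ (take n Y) (trans (lookup-take n Y x) (Vec.[]=⇒lookup p))

module Projection (ℝ : RealLine) where
  open RealLine ℝ using (_<_)
  open Semantics ℝ renaming (_≤_ to infix 4 _≤_)
  open Line ℝ
  open Words ℝ

  anyTrue⇒Nonempty : ∀ {m} (v : Vec Bool m) → anyTrue v ≡ true → Nonempty v
  anyTrue⇒Nonempty (true ∷ v)  _ = zero , Vec.here
  anyTrue⇒Nonempty (false ∷ v) h = let x , p = anyTrue⇒Nonempty v h in suc x , Vec.there p

  Nonempty⇒anyTrue : ∀ {m} (v : Vec Bool m) → Nonempty v → anyTrue v ≡ true
  Nonempty⇒anyTrue (true ∷ v)  _ = refl
  Nonempty⇒anyTrue (false ∷ v) (suc x , Vec.there p) = Nonempty⇒anyTrue v (x , p)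

  -- The graph of `proj`, given inductively so that the map `embed` of positions is a recursion on
  -- it rather than on Boolean tests.
  data Proj (n : ℕ) {k : ℕ} : Word (n ℕ.+ k) → Word n → Set where
    []   : Proj n [] []
    keep : ∀ {Y t ρ′ ρ} → Nonempty (take n Y) → Proj n ρ′ ρ → Proj n ((Y , t) ∷ ρ′) ((take n Y , t) ∷ ρ)
    skip : ∀ {Y t ρ′ ρ} → ¬ Nonempty (take n Y) → Proj n ρ′ ρ → Proj n ((Y , t) ∷ ρ′) ρ

  proj-Proj : ∀ n {k} (ρ′ : Word (n ℕ.+ k)) → Proj n ρ′ (proj n ρ′)
  proj-Proj n [] = []
  proj-Proj n ((Y , t) ∷ ρ′) with anyTrue (take n Y) in eq
  ... | true  = keep (anyTrue⇒Nonempty _ eq) (proj-Proj n ρ′)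
  ... | false = skip (λ ne → contradiction (trans (sym (Nonempty⇒anyTrue _ ne)) eq) λ ()) (proj-Proj n ρ′)

  module _ {n k : ℕ} where

    embed : ∀ {ρ′ : Word (n ℕ.+ k)} {ρ} → Proj n ρ′ ρ → Fin (length ρ) → Fin (length ρ′)
    embed (keep _ π) zero    = zero
    embed (keep _ π) (suc i) = suc (embed π i)
    embed (skip _ π) i       = suc (embed π i)

    embed-mono : ∀ {ρ′ : Word (n ℕ.+ k)} {ρ} (π : Proj n ρ′ ρ) {i j} → i Fin.< j → embed π i Fin.< embed π j
    embed-mono (keep _ π) {zero}  {suc j} _         = s≤s z≤n
    embed-mono (keep _ π) {suc i} {suc j} (s≤s i<j) = s≤s (embed-mono π i<j)
    embed-mono (skip _ π) i<j = s≤s (embed-mono π i<j)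

    embed-time : ∀ {ρ′ : Word (n ℕ.+ k)} {ρ} (π : Proj n ρ′ ρ) i → time ρ′ (embed π i) ≡ time ρ i
    embed-time (keep _ π) zero    = refl
    embed-time (keep _ π) (suc i) = embed-time π i
    embed-time (skip _ π) i       = embed-time π i

    embed-lab : ∀ {ρ′ : Word (n ℕ.+ k)} {ρ} (π : Proj n ρ′ ρ) i → take n (lab ρ′ (embed π i)) ≡ lab ρ i
    embed-lab (keep _ π) zero    = refl
    embed-lab (keep _ π) (suc i) = embed-lab π i
    embed-lab (skip _ π) i       = embed-lab π i

    embed-action : ∀ {ρ′ : Word (n ℕ.+ k)} {ρ} (π : Proj n ρ′ ρ) i → Nonempty (take n (lab ρ′ (embed π i)))
    embed-action (keep ne π) zero    = ne
    embed-action (keep _ π)  (suc i) = embed-action π i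
    embed-action (skip _ π)  i       = embed-action π i

    action-embed : ∀ {ρ′ : Word (n ℕ.+ k)} {ρ} (π : Proj n ρ′ ρ) p → Nonempty
        (take n (lab ρ′ p)) → ∃ λ i → embed π i ≡ p
    action-embed (keep _ π)  zero    _  = zero , refl
    action-embed (keep _ π)  (suc p) ne = let i , eq = action-embed π p ne in suc i , cong suc eq
    action-embed (skip ¬e π) zero    ne = contradiction ne ¬e
    action-embed (skip _ π)  (suc p) ne = let i , eq = action-embed π p ne in i , cong suc eq

  normalise-In⇒ : ∀ I {y x} → In (normalise I) y x → In I y x
  normalise-In⇒ (interval zero    true  hi hc) (p , q) = inj₁ p , q
  normalise-In⇒ (interval zero    false hi hc) h = h
  normalise-In⇒ (interval (suc l) lc    hi hc) h = h

  normalise-In⇐ : ∀ I {y x} → y < x → In I y x → In (normalise I) y x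
  normalise-In⇐ (interval zero    lc hi hc) y<x (_ , q) = subst (_< _) (sym (⊕-identityʳ _)) y<x , q
  normalise-In⇐ (interval (suc l) lc hi hc) _ h = h

  improper-empty : ∀ I {y x} → NonSingular I → ¬ Proper I → ¬ In I y x
  improper-empty (interval l lc nothing  hc) _ ¬p _ = ¬p _
  improper-empty (interval l lc (just u) hc) {y} {x} ns l≮u (p , q) with ℕ.m≤n⇒m<n∨m≡n (ℕ.≮⇒≥ l≮u)
  ... | inj₁ u<l = <⇒≱ (⊕-monoʳ-< y u<l) (≤-trans (≲⇒≤ lc p) (≲⇒≤ hc q))
  ... | inj₂ refl = go lc hc p q ns
    where
    go : ∀ lc hc → y ⊕ l ≲[ lc ] x → x ≲[ hc ] y ⊕ l → NonSingular (interval l lc (just l) hc) → ⊥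
    go true  true  _ _ ns = ns (refl , refl , refl)
    go true  false p q _  = <⇒≱ q p
    go false hc    p q _  = <⇒≱ p (≲⇒≤ hc q)

  BP⇒min : ∀ {m} {ρ : Word m} {i} → Sat ρ i BP → (j : Fin (length ρ)) → i Fin.≤ j
  BP⇒min i≡0 j = ℕ.≤-trans (ℕ.≤-reflexive i≡0) z≤n

  min⇒BP : ∀ {m} {ρ : Word m} {i} → (∀ j → i Fin.≤ j) → Sat ρ i BP
  min⇒BP {i = i} i≤ = let z , z≡0 , _ = first i in ℕ.n≤0⇒n≡0 (subst (toℕ i ℕ.≤_) z≡0 (i≤ z))

  EP⇒max : ∀ {m} {ρ : Word m} {i} → Sat ρ i EP → ∀ j → j Fin.≤ i
  EP⇒max eq j = ℕ.≤-pred (subst (toℕ j ℕ.<_) (sym eq) (Fin.toℕ<n j))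

  lastPosition : ∀ {m} (ρ : Word m) → Fin (length ρ) → ∃ λ j → Sat ρ j EP
  lastPosition (_ ∷ ρ) _ = Fin.fromℕ (length ρ) , cong suc (Fin.toℕ-fromℕ (length ρ))

  max⇒EP : ∀ {m} {ρ : Word m} {i} → (∀ j → j Fin.≤ i) → Sat ρ i EP
  max⇒EP {ρ = ρ} {i} ≤i = let j , j≡ = lastPosition ρ i in
    ℕ.≤-antisym (Fin.toℕ<n i) (subst (ℕ._≤ suc (toℕ i)) j≡ (s≤s (≤i j)))

  module Correctness {n k : ℕ} {ρ′ : Word (n ℕ.+ k)} {ρ : Word n} (π : Proj n ρ′ ρ) (sorted : Sorted ρ′)
                     (framed : ∀ p → Sat ρ′ p (Translation.wellFramed n k)) where
    open Translation n k public
    open Logic ρ′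
    module O = Order ρ′ sorted

    f : Fin (length ρ) → Fin (length ρ′)
    f = embed π

    f-cancel-< : ∀ {i j} → f i Fin.< f j → i Fin.< j
    f-cancel-< {i} {j} p with Fin.<-cmp i j
    ... | tri< i<j _ _ = i<j
    ... | tri≈ _ refl _ = contradiction p (ℕ.<-irrefl refl)
    ... | tri> _ _ j<i = contradiction p (ℕ.<-asym (embed-mono π j<i))

    f-cancel-≤ : ∀ {i j} → f i Fin.≤ f j → i Fin.≤ j
    f-cancel-≤ p = ℕ.≮⇒≥ λ j<i → ℕ.<⇒≱ (embed-mono π j<i) p

    f-mono-≤ : ∀ {i j} → i Fin.≤ j → f i Fin.≤ f j
    f-mono-≤ p = ℕ.≮⇒≥ λ j<i → ℕ.<⇒≱ (f-cancel-< j<i) p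

    act-f : ∀ i → Sat ρ′ (f i) act
    act-f i = let x , q = embed-action π i in ⋁-intro n (λ x → atom (x ↑ˡ k)) x (∈-take⇒ n _ q)

    f-act : ∀ {p} → Sat ρ′ p act → ∃ λ i → f i ≡ p
    f-act {p} h = let x , q = ⋁-elim n (λ x → atom (x ↑ˡ k)) h in action-embed π p (x , ∈-take⇐ n _ q)

    Agree : Form (Fin (n ℕ.+ k)) → Form (Fin n) → Set
    Agree φ′ φ = ∀ i → (Sat ρ′ (f i) φ′ → Sat ρ i φ) × (Sat ρ i φ → Sat ρ′ (f i) φ′)

    all-act-elim : ∀ {φ′ φ} → Agree φ′ φ → ∀ {i} → Sat ρ′ (f i) (act ⇒ φ′) → Sat ρ i φ
    all-act-elim {φ′} agree {i} h = proj₁ (agree i) (⇒-elim {i = f i} act φ′ h (act-f i))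

    all-act-intro : ∀ {φ′ φ} → Agree φ′ φ → ∀ {p} → (∀ i → f i ≡ p → Sat ρ i φ) → Sat ρ′ p (act ⇒ φ′)
    all-act-intro {φ′} agree {p} h = ⇒-intro {i = p} act φ′ λ ap → let i , fi≡p = f-act ap in
      subst (λ q → Sat ρ′ q φ′) fi≡p (proj₂ (agree i) (h i fi≡p))

    some-act-elim : ∀ {φ′ φ} → Agree φ′ φ → ∀ {p} → Sat ρ′ p (act ∧ φ′) → ∃ λ i → f i ≡ p × Sat ρ i φ
    some-act-elim {φ′} agree (ap , h) = let i , fi≡p = f-act ap in
      i , fi≡p , proj₁ (agree i) (subst (λ q → Sat ρ′ q φ′) (sym fi≡p) h)

    some-act-intro : ∀ {φ′ φ} → Agree φ′ φ → ∀ {i} → Sat ρ i φ → Sat ρ′ (f i) (act ∧ φ′)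
    some-act-intro agree {i} h = act-f i , proj₂ (agree i) h

    diff-f : ∀ I i j → In I (O.τ (f i)) (O.τ (f j)) ≡ In I (time ρ i) (time ρ j)
    diff-f I i j = cong₂ (In I) (embed-time π i) (embed-time π j)

    agree-BP : Agree BP BP
    agree-BP i = (λ h → min⇒BP {ρ = ρ} λ j → f-cancel-≤ (BP⇒min {ρ = ρ′} {f i} h (f j)))
               , λ h → let z , z≡0 , z≤ = first (f i)
                           j , fj≡z = f-act (⇒-elim {i = z} BP act (proj₁ (framed z)) z≡0)
                       in min⇒BP {ρ = ρ′} λ p → ℕ.≤-trans (f-mono-≤ (BP⇒min {ρ = ρ} {i} h j))
                            (ℕ.≤-trans (ℕ.≤-reflexive (cong toℕ fj≡z)) (z≤ p))

    agree-EP : Agree EP EP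
    agree-EP i = (λ h → max⇒EP {ρ = ρ} λ j → f-cancel-≤ (EP⇒max {ρ = ρ′} {f i} h (f j)))
               , λ h → let z , zEP = lastPosition ρ′ (f i)
                           j , fj≡z = f-act (⇒-elim {i = z} EP act (proj₂ (framed z)) zEP)
                       in max⇒EP {ρ = ρ′} λ p → ℕ.≤-trans (EP⇒max {ρ = ρ′} {i = z} zEP p)
                            (ℕ.≤-trans (ℕ.≤-reflexive (cong toℕ (sym fj≡z))) (f-mono-≤ (EP⇒max {ρ = ρ} {i} h j)))

    agree-U : ∀ I {φ′ ψ′ φ ψ} → Agree φ′ φ → Agree ψ′ ψ → Agree (U[ I ] (act ⇒ φ′) (act ∧ ψ′)) (U[ I ] φ ψ)
    agree-U I {φ′} {ψ′} {φ} {ψ} aφ aψ i = to , from′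
      where
      to : Sat ρ′ (f i) (U[ I ] (act ⇒ φ′) (act ∧ ψ′)) → Sat ρ i (U[ I ] φ ψ)
      to (p , i<p , ψp , d , run) with some-act-elim aψ ψp
      ... | j , refl , ψj = j , f-cancel-< i<p , ψj , In⇒∈I I (subst (λ S → S) (diff-f I i j) (∈I⇒In I d)) ,
            λ r i<r r<j → all-act-elim aφ (run (f r) (embed-mono π i<r) (embed-mono π r<j))
      from′ : Sat ρ i (U[ I ] φ ψ) → Sat ρ′ (f i) (U[ I ] (act ⇒ φ′) (act ∧ ψ′))
      from′ (j , i<j , ψj , d , run) = f j , embed-mono π i<j , some-act-intro aψ ψj ,
        In⇒∈I I (subst (λ S → S) (sym (diff-f I i j)) (∈I⇒In I d)) ,
        λ p i<p p<j → all-act-intro aφ {p} λ { r refl → run r (f-cancel-< i<p) (f-cancel-< p<j) }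

    agree-S : ∀ I β γ e → NonSingular I → let open Letters β γ e in
              Agree (translate β eβ) β → Agree (translate γ eγ) γ → (∀ p → Sat ρ′ p (define I)) →
              Agree (atom (e zero)) (S[ I ] β γ)
    agree-S I β γ e ns aβ aγ m i with proper? I
    ... | no ¬p = (λ h → contradiction h (m (f i))) ,
                  λ (_ , _ , _ , d , _) → contradiction (∈I⇒In I d) (improper-empty I ns ¬p)
    ... | yes p = to , λ h → decidable-stable (Sat? ρ′ (f i) (atom (e zero))) (from′ h)
      where
      open Letters β γ e
      I′ = normalise I
      module Snd = Soundness ℝ ρ′ sorted act β̂ γ̂ (atom (e zero)) (atom (e (suc zero))) (atom (e (suc (suc zero)))) (atom (e (suc (suc (suc zero)))))
      to : Sat ρ′ (f i) (atom (e zero)) → Sat ρ i (S[ I ] β γ)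
      to wi = project (Snd.own⇒since I′ (normalise-normal I) (normalise-proper I p) m (act-f i , wi))
        where
        project : Snd.Witness I′ (f i) → Sat ρ i (S[ I ] β γ)
        project (q , q<i , γq , d , run) with some-act-elim aγ γq
        ... | j , refl , γj = j , f-cancel-< q<i , γj , In⇒∈I I (subst (λ S → S) (diff-f I j i) (normalise-In⇒ I d)) ,
              λ r j<r r<i → all-act-elim aβ (run (f r) (embed-mono π j<r) (embed-mono π r<i))
      complete : ∀ I′ → (∀ q → Sat ρ′ q (own I′)) → ∀ q → Sat ρ′ q (γ̂ ⇒ ¬' (U[ I′ ] β̂ (act ∧ ¬' (atom (e zero)))))
      complete (interval _ _ _ _) m q = proj₁ (proj₂ (m q))
      from′ : Sat ρ i (S[ I ] β γ) → ¬ ¬ Sat ρ′ (f i) (atom (e zero))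
      from′ (j , j<i , γj , d , run) ¬w =
        ⇒-elim {i = f j} γ̂ (¬' (U[ I′ ] β̂ (act ∧ ¬' (atom (e zero))))) (complete I′ m (f j)) (some-act-intro aγ γj)
          (f i , embed-mono π j<i , (act-f i , ¬w) ,
           In⇒∈I I′ (normalise-In⇐ I (O.time-mono-< (embed-mono π j<i))
               (subst (λ S → S) (sym (diff-f I j i)) (∈I⇒In I d))) ,
           λ q j<q q<i → all-act-intro aβ {q} λ { r refl → run r (f-cancel-< j<q) (f-cancel-< q<i) })

    translate-correct : ∀ {φ} → SinceNS φ → ∀ e → (∀ p → Sat ρ′ p (constraints φ e)) → Agree (translate φ e) φ
    translate-correct (atom x) e m i = (λ h → subst (x ∈_) (embed-lab π i) (∈-take⇐ n _ h))
                                     , λ h → ∈-take⇒ n _ (subst (x ∈_) (sym (embed-lab π i)) h)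
    translate-correct BP e m = agree-BP
    translate-correct EP e m = agree-EP
    translate-correct tt e m i = _
    translate-correct (φ ∧ ψ) e m i =
      let f₁ , g₁ = translate-correct φ _ (proj₁ ∘ m) i
          f₂ , g₂ = translate-correct ψ _ (proj₂ ∘ m) i
      in (λ (p , q) → f₁ p , f₂ q) , λ (p , q) → g₁ p , g₂ q
    translate-correct (¬' φ) e m i =
      let f₁ , g₁ = translate-correct φ e m i in (λ h p → h (g₁ p)) , λ h p → h (f₁ p)
    translate-correct (U[ I ] φ ψ) e m =
      agree-U I (translate-correct φ _ (proj₁ ∘ m)) (translate-correct ψ _ (proj₂ ∘ m))
    translate-correct (S[_] {I} {β} {γ} ns φ ψ) e m =
      agree-S I β γ e ns (translate-correct φ _ (proj₁ ∘ proj₂ ∘ m))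
          (translate-correct ψ _ (proj₂ ∘ proj₂ ∘ m)) (proj₁ ∘ m)

-- The oversampled word.

last-∷ : ∀ {A : Set} (x : A) xs → List.last (x ∷ xs) ≡ just (Maybe.fromMaybe x (List.last xs))
last-∷ x []       = refl
last-∷ x (y ∷ ys) rewrite last-∷ y ys = refl

last-map : ∀ {A B : Set} (f : A → B) xs → List.last (List.map f xs) ≡ Maybe.map f (List.last xs)
last-map f []           = refl
last-map f (x ∷ [])     = refl
last-map f (x ∷ y ∷ xs) = last-map f (y ∷ xs)

last-lookup : ∀ {A : Set} (xs : List A) i → suc (toℕ i) ≡ length xs → List.last xs ≡ just (List.lookup xs i)
last-lookup (x ∷ [])     zero    _  = refl
last-lookup (x ∷ y ∷ xs) (suc i) eq = last-lookup (y ∷ xs) i (ℕ.suc-injective eq)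

take-++ : ∀ {A : Set} {n k} (v : Vec A n) (v′ : Vec A k) → take n (v Vec.++ v′) ≡ v
take-++ []      v′ = refl
take-++ (x ∷ v) v′ = cong (x ∷_) (take-++ v v′)

module Oversampled (ℝ : RealLine) {n : ℕ} (x₀ : Subset n × Semantics.R ℝ) (ρ₁ : Semantics.Word ℝ n)
                   (timed : Semantics.IsTimedWord ℝ (x₀ ∷ ρ₁))
                   {k : ℕ} (meaning : Fin k → ℕ × Form (Fin n)) where
  open RealLine ℝ using (0#; _<_)
  open Semantics ℝ renaming (_≤_ to infix 4 _≤_)
  open Line ℝ
  open Words ℝ
  open Projection ℝ

  ρ : Word n
  ρ = x₀ ∷ ρ₁

  t₀ : R
  t₀ = proj₂ x₀

  Means : Fin k → R → Set
  Means x t = ∃ λ i → time ρ i ⊕ proj₁ (meaning x) ≡ t × Sat ρ i (proj₂ (meaning x))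

  means? : ∀ x t → Dec (Means x t)
  means? x t = Fin.any? λ i → (time ρ i ⊕ proj₁ (meaning x) ≟ t) ×-dec Sat? ρ i (proj₂ (meaning x))

  -- The first new letter holds everywhere: it keeps the labels of added positions nonempty.
  newLetters : R → Subset (suc k)
  newLetters t = true ∷ Vec.tabulate λ x → does (means? x t)

  extend : Subset n × R → Subset (n ℕ.+ suc k) × R
  extend (Y , t) = Y Vec.++ newLetters t , t

  blank : R → Subset n × R
  blank t = Vec.replicate n false , t

  -- A time beyond the last position is dropped and an existing time is not repeated, so that the
  -- last position remains the original one.
  insert : R → Word n → Word n
  insert t []      = []
  insert t (x ∷ σ) with compare t (proj₂ x)
  ... | tri< _ _ _ = blank t ∷ x ∷ σ
  ... | tri≈ _ _ _ = x ∷ σ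
  ... | tri> _ _ _ = x ∷ insert t σ

  insertAfter : R → Word n → Word n
  insertAfter t σ with t₀ <? t
  ... | yes _ = insert t σ
  ... | no  _ = σ

  insert-All : ∀ (P : R → Set) {t} → P t → ∀ σ → All P (times σ) → All P (times (insert t σ))
  insert-All P Pt []      ps = ps
  insert-All P {t} Pt (x ∷ σ) (p ∷ ps) with compare t (proj₂ x)
  ... | tri< _ _ _ = Pt ∷ p ∷ ps
  ... | tri≈ _ _ _ = p ∷ ps
  ... | tri> _ _ _ = p ∷ insert-All P Pt σ ps

  insert-sorted : ∀ t σ → AllPairs _<_ (times σ) → AllPairs _<_ (times (insert t σ))
  insert-sorted t []      ps = ps
  insert-sorted t (x ∷ σ) (p ∷ ps) with compare t (proj₂ x)
  ... | tri< t<x _ _ = (t<x ∷ All.map (<-trans t<x) p) ∷ p ∷ ps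
  ... | tri≈ _ _ _   = p ∷ ps
  ... | tri> _ _ x<t = insert-All (proj₂ x <_) x<t σ p ∷ insert-sorted t σ ps

  insert-last : ∀ t σ → List.last (insert t σ) ≡ List.last σ
  insert-last t []      = refl
  insert-last t (x ∷ σ) with compare t (proj₂ x)
  ... | tri< _ _ _ = refl
  ... | tri≈ _ _ _ = refl
  ... | tri> _ _ _ = trans (last-∷ x (insert t σ)) (trans (cong (just ∘ Maybe.fromMaybe x) (insert-last t σ))
      (sym (last-∷ x σ)))

  insert-⊇ : ∀ t σ {s} → s ∈ᴸ times σ → s ∈ᴸ times (insert t σ)
  insert-⊇ t (x ∷ σ) s∈ with compare t (proj₂ x)
  insert-⊇ t (x ∷ σ) s∈         | tri< _ _ _ = there s∈
  insert-⊇ t (x ∷ σ) s∈         | tri≈ _ _ _ = s∈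
  insert-⊇ t (x ∷ σ) (here eq)  | tri> _ _ _ = here eq
  insert-⊇ t (x ∷ σ) (there s∈) | tri> _ _ _ = there (insert-⊇ t σ s∈)

  insert-∋ : ∀ t σ {s} → s ∈ᴸ times σ → t ≤ s → t ∈ᴸ times (insert t σ)
  insert-∋ t (x ∷ σ) s∈ t≤s with compare t (proj₂ x)
  insert-∋ t (x ∷ σ) s∈          t≤s | tri< _ _ _   = here refl
  insert-∋ t (x ∷ σ) s∈          t≤s | tri≈ _ t≡x _ = here t≡x
  insert-∋ t (x ∷ σ) (here refl) t≤s | tri> _ _ x<t = contradiction t≤s (<⇒≱ x<t)
  insert-∋ t (x ∷ σ) (there s∈)  t≤s | tri> _ _ _   = there (insert-∋ t σ s∈ t≤s)

  anyTrue-blank : ∀ m → anyTrue (Vec.replicate m false) ≡ false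
  anyTrue-blank zero    = refl
  anyTrue-blank (suc m) = anyTrue-blank m

  proj-extend : ∀ Y t σ → proj n (extend (Y , t) ∷ σ) ≡ (if anyTrue Y then (Y , t) ∷ proj n σ else proj n σ)
  proj-extend Y t σ rewrite take-++ Y (newLetters t) = refl

  proj-blank : ∀ t σ → proj n (extend (blank t) ∷ σ) ≡ proj n σ
  proj-blank t σ = trans (proj-extend _ t σ) (cong (if_then (blank t ∷ proj n σ) else proj n σ) (anyTrue-blank n))

  proj-keep : ∀ Y t σ → Nonempty Y → proj n (extend (Y , t) ∷ σ) ≡ (Y , t) ∷ proj n σ
  proj-keep Y t σ ne = trans (proj-extend Y t σ) (cong (if_then ((Y , t) ∷ proj n σ) else proj n σ)
      (Nonempty⇒anyTrue Y ne))

  proj-cong : ∀ x σ σ′ → proj n σ ≡ proj n σ′ → proj n (extend x ∷ σ) ≡ proj n (extend x ∷ σ′)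
  proj-cong (Y , t) σ σ′ eq = trans (proj-extend Y t σ)
    (trans (cong (λ u → if anyTrue Y then (Y , t) ∷ u else u) eq) (sym (proj-extend Y t σ′)))

  insert-proj : ∀ t σ → proj n (List.map extend (insert t σ)) ≡ proj n (List.map extend σ)
  insert-proj t []      = refl
  insert-proj t (x ∷ σ) with compare t (proj₂ x)
  ... | tri< _ _ _ = proj-blank t (List.map extend (x ∷ σ))
  ... | tri≈ _ _ _ = refl
  ... | tri> _ _ _ = proj-cong x (List.map extend (insert t σ)) (List.map extend σ) (insert-proj t σ)

  base-proj : ∀ σ → All (Nonempty ∘ proj₁) σ → proj n (List.map extend σ) ≡ σ
  base-proj []            []        = refl
  base-proj ((Y , t) ∷ σ) (ne ∷ ps) = trans (proj-keep Y t (List.map extend σ) ne)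
      (cong ((Y , t) ∷_) (base-proj σ ps))

  record Refines (σ : Word n) : Set where
    field
      increasing : AllPairs _<_ (t₀ ∷ times σ)
      sameLast   : List.last σ ≡ List.last ρ₁
      sameProj   : proj n (List.map extend σ) ≡ ρ₁
      contains   : ∀ {s} → s ∈ᴸ times ρ₁ → s ∈ᴸ times σ
  open Refines

  refines-base : Refines ρ₁
  refines-base = record
    { increasing = Linked⇒AllPairs <-trans (proj₂ (proj₂ (proj₂ timed)))
    ; sameLast = refl
    ; sameProj = base-proj ρ₁ (All.tail (proj₁ (proj₂ timed)))
    ; contains = λ s∈ → s∈ }

  refines-step : ∀ t {σ} → Refines σ → Refines (insertAfter t σ)
  refines-step t {σ} h with t₀ <? t
  ... | no _     = h
  ... | yes t₀<t = record
    { increasing = extendHead (increasing h)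
    ; sameLast = trans (insert-last t σ) (sameLast h)
    ; sameProj = trans (insert-proj t σ) (sameProj h)
    ; contains = λ s∈ → insert-⊇ t σ (contains h s∈) }
    where
    extendHead : AllPairs _<_ (t₀ ∷ times σ) → AllPairs _<_ (t₀ ∷ times (insert t σ))
    extendHead (p ∷ ps) = insert-All (t₀ <_) t₀<t σ p ∷ insert-sorted t σ ps

  refine : List R → Word n
  refine = List.foldr insertAfter ρ₁

  refine-refines : ∀ ts → Refines (refine ts)
  refine-refines []       = refines-base
  refine-refines (t ∷ ts) = refines-step t (refine-refines ts)

  insertAfter-⊇ : ∀ t σ {s} → s ∈ᴸ times σ → s ∈ᴸ times (insertAfter t σ)
  insertAfter-⊇ t σ s∈ with t₀ <? t
  ... | yes _ = insert-⊇ t σ s∈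
  ... | no _  = s∈

  refine-∋ : ∀ ts {t s} → t ∈ᴸ ts → s ∈ᴸ times ρ₁ → t₀ < t → t ≤ s → t ∈ᴸ times (refine ts)
  refine-∋ (t ∷ ts) (here refl) s∈ t₀<t t≤s with t₀ <? t
  ... | yes _ = insert-∋ t (refine ts) (contains (refine-refines ts) s∈) t≤s
  ... | no ¬p = contradiction t₀<t ¬p
  refine-∋ (t′ ∷ ts) (there t∈) s∈ t₀<t t≤s = insertAfter-⊇ t′ (refine ts) (refine-∋ ts t∈ s∈ t₀<t t≤s)

  -- Every position is combined with the delay of every letter, whether or not the meaning of the
  -- letter holds there. The existence of the positions is thus settled independently of
  -- satisfaction.
  markTimes : List R
  markTimes = List.cartesianProductWith (λ i x → time ρ i ⊕ proj₁ (meaning x)) (List.allFin _) (List.allFin k)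

  σ : Word n
  σ = x₀ ∷ refine markTimes

  refines : Refines (refine markTimes)
  refines = refine-refines markTimes

  ρ′ : Word (n ℕ.+ suc k)
  ρ′ = List.map extend σ

  times-ρ′ : times ρ′ ≡ times σ
  times-ρ′ = sym (map-∘ σ)

  sorted′ : Sorted ρ′
  sorted′ = subst (Linked _<_) (sym times-ρ′) (AllPairs⇒Linked (increasing refines))

  timed′ : IsTimedWord ρ′
  timed′ = s≤s z≤n
         , All.map⁺ (All.universal (λ (Y , t) → n ↑ʳ zero , Vec.lookup⇒[]= _ _
             (Vec.lookup-++ʳ Y (newLetters t) zero)) σ)
         , All.map⁺ (All.map⁻ (nonneg (increasing refines)))
         , sorted′
    where
    nonneg : AllPairs _<_ (times σ) → All (0# ≤_) (times σ)
    nonneg (p ∷ _) = let 0≤t₀ = All.head (proj₁ (proj₂ (proj₂ timed))) in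
                     0≤t₀ ∷ All.map (λ t₀<t → inj₁ (≤-<-trans 0≤t₀ t₀<t)) p

  oversampling : Oversampling n ρ′ ρ
  oversampling = trans (proj-keep (proj₁ x₀) t₀ (List.map extend (refine markTimes)) (All.head nonempty))
                       (cong (x₀ ∷_) (sameProj refines))
               , (λ { _ refl → action x₀ (All.head nonempty) })
               , λ x eq → lastAction x (trans (sym lastEq) eq)
    where
    nonempty : All (Nonempty ∘ proj₁) ρ
    nonempty = proj₁ (proj₂ timed)
    action : ∀ x → Nonempty (proj₁ x) → ActionPoint n (extend x)
    action (Y , t) ne = subst Nonempty (sym (take-++ Y (newLetters t))) ne
    lastEq : List.last ρ′ ≡ Maybe.map extend (List.last ρ)
    lastEq = trans (last-map extend σ) (cong (Maybe.map extend)
      (trans (last-∷ x₀ (refine markTimes)) (trans (cong (just ∘ Maybe.fromMaybe x₀) (sameLast refines))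
          (sym (last-∷ x₀ ρ₁)))))
    lastNonempty : ∀ xs {x} → All (Nonempty ∘ proj₁) xs → Maybe.map extend (List.last xs) ≡ just x → ActionPoint n x
    lastNonempty (x ∷ [])     (ne ∷ _)  refl = action x ne
    lastNonempty (_ ∷ y ∷ xs) (_ ∷ nes) eq   = lastNonempty (y ∷ xs) nes eq
    lastAction : ∀ x → Maybe.map extend (List.last ρ) ≡ just x → ActionPoint n x
    lastAction x = lastNonempty ρ nonempty

  letter : Fin k → Fin (n ℕ.+ suc k)
  letter x = n ↑ʳ suc x

  lookup-letter : ∀ p x → lookup (lab ρ′ p) (letter x) ≡ does (means? x (time ρ′ p))
  lookup-letter p x = All.lookup {P = λ y → lookup (proj₁ y) (letter x) ≡ does (means? x (proj₂ y))}
                        (All.map⁺ (All.universal spec σ)) (∈-lookup p)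
    where
    spec : ∀ y → lookup (proj₁ (extend y)) (letter x) ≡ does (means? x (proj₂ (extend y)))
    spec (Y , t) = trans (Vec.lookup-++ʳ Y (newLetters t) (suc x)) (Vec.lookup∘tabulate _ x)

  letter⇒means : ∀ {p} x → letter x ∈ lab ρ′ p → Means x (time ρ′ p)
  letter⇒means {p} x h = does-true (means? x (time ρ′ p)) (trans (sym (lookup-letter p x)) (Vec.[]=⇒lookup h))
    where
    does-true : ∀ {P : Set} (P? : Dec P) → does P? ≡ true → P
    does-true (yes p) _ = p

  means⇒letter : ∀ {p} x → Means x (time ρ′ p) → letter x ∈ lab ρ′ p
  means⇒letter {p} x m = Vec.lookup⇒[]= _ _ (trans (lookup-letter p x) (dec-true (means? x (time ρ′ p)) m))

  ∈-position : ∀ {t} → t ∈ᴸ times ρ′ → ∃ λ p → time ρ′ p ≡ t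
  ∈-position t∈ with ∈-map⁻ proj₂ t∈
  ... | y , y∈ , t≡ = Any.index y∈ , trans (cong proj₂ (sym (Any.lookup-index y∈))) (sym t≡)

  mark-position : ∀ x i i′ → time ρ i ⊕ proj₁ (meaning x) ≤ time ρ i′ → ∃ λ p → time ρ′ p ≡ time ρ i ⊕ proj₁
      (meaning x)
  mark-position x i i′ t≤ = ∈-position (subst (t ∈ᴸ_) (sym times-ρ′) (go (t₀≤ i) (∈-map⁺ proj₂ (∈-lookup i′))))
    where
    t = time ρ i ⊕ proj₁ (meaning x)
    t₀≤ : ∀ i → t₀ ≤ time ρ i ⊕ proj₁ (meaning x)
    t₀≤ i = ≤-trans (Order.time-mono-≤ ρ (proj₂ (proj₂ (proj₂ timed))) {zero} {i} z≤n) (x≤x⊕n (proj₁ (meaning x)))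
    go : t₀ ≤ t → time ρ i′ ∈ᴸ times ρ → t ∈ᴸ times σ
    go (inj₂ t₀≡t) _ = here (sym t₀≡t)
    go (inj₁ t₀<t) (here eq)  = contradiction (≤-trans t≤ (inj₂ eq)) (<⇒≱ t₀<t)
    go (inj₁ t₀<t) (there s∈) =
      there (refine-∋ markTimes (∈-cartesianProductWith⁺ _ (∈-allFin i) (∈-allFin x)) s∈ t₀<t t≤)

-- Completeness: the intended labels satisfy the constraints.

enduring : ∀ {A} → ℕ → Form A → Form A → Form A
enduring l β γ = γ ∧ ¬' (F[ rightOpen 0 l ] (¬' β))

-- It may look into the past, as it is evaluated on the original word only, to choose the labels.
-- `F[ from l ] tt` discards positions whose mark would fall after the end of the word. `β` is
-- tested at the position itself because `S` tests it strictly between. For `l = 0` marks need not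
-- be sparse, and every `γ` is a source.
sourceOf : ∀ {A} → Interval → Form A → Form A → Form A
sourceOf (interval zero lc hi hc)        β γ = γ
sourceOf I@(interval l@(suc _) lc hi hc) β γ =
  enduring l β γ ∧ F[ from l ] tt ∧ ¬' (β ∧ S[ gap I ] β (enduring l β γ))

endOf : ∀ {A} → Interval → Form A → Form A
endOf I γ = γ ∧ ¬' (F[ gap I ] γ)

upper : Interval → ℕ
upper I = Maybe.fromMaybe 0 (Interval.hi I)

sourceOf⇒γ : ∀ (ℝ : RealLine) {n} {ρ : Semantics.Word ℝ n} I β γ {s} →
             Semantics.Sat ℝ ρ s (sourceOf I β γ) → Semantics.Sat ℝ ρ s γ
sourceOf⇒γ ℝ (interval zero lc hi hc)    β γ h = h
sourceOf⇒γ ℝ (interval (suc _) lc hi hc) β γ ((h , _) , _) = h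

module Completeness (ℝ : RealLine) {n k : ℕ} {ρ′ : Semantics.Word ℝ (n ℕ.+ k)} {ρ : Semantics.Word ℝ n}
    (π : Projection.Proj ℝ n ρ′ ρ) (sorted′ : Words.Sorted ℝ ρ′) (sorted : Words.Sorted ℝ ρ)
    (framed : ∀ p → Semantics.Sat ℝ ρ′ p (Translation.wellFramed n k)) where
  open RealLine ℝ using (_<_)
  open Semantics ℝ renaming (_≤_ to infix 4 _≤_)
  open Line ℝ
  open Words ℝ
  open Projection ℝ
  open Correctness π sorted′ framed
  open Logic ρ′
  open Order ρ sorted
  open O using () renaming (τ to τ′)
  module B = Logic ρ

  f-time : ∀ i → τ′ (f i) ≡ τ i
  f-time = embed-time π

  at-time : ∀ {i p} → τ i ≡ τ′ p → f i ≡ p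
  at-time {i} eq = O.time-injective (trans (f-time i) eq)

  -- The letter `χ′` is `χ` delayed by `c`. The field `exists` asks for an original position at or
  -- after the mark, as no position is added past the end of the word.
  record Marks (χ′ : Form (Fin (n ℕ.+ k))) (c : ℕ) (χ : Form (Fin n)) : Set where
    field
      origin : ∀ {p} → Sat ρ′ p χ′ → ∃ λ i → τ i ⊕ c ≡ τ′ p × Sat ρ i χ
      holds  : ∀ {p} i → τ i ⊕ c ≡ τ′ p → Sat ρ i χ → Sat ρ′ p χ′
      exists : ∀ i {i′} → τ i ⊕ c ≤ τ i′ → ∃ λ p → τ′ p ≡ τ i ⊕ c
  open Marks

  origin₀ : ∀ {χ′ χ} → Marks χ′ 0 χ → ∀ {p} → Sat ρ′ p χ′ → ∃ λ i → f i ≡ p × Sat ρ i χ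
  origin₀ m h = let i , eq , s = origin m h in i , at-time (trans (sym (⊕-identityʳ _)) eq) , s

  holds₀ : ∀ {χ′ χ} → Marks χ′ 0 χ → ∀ i → Sat ρ i χ → Sat ρ′ (f i) χ′
  holds₀ m i h = holds m i (trans (⊕-identityʳ _) (sym (f-time i))) h

  module _ (l : ℕ) (lc : Bool) (hi : Maybe ℕ) (hc : Bool) (proper : Proper (interval l lc hi hc))
           {β γ : Form (Fin n)} {β′ γ′ w a b e : Form (Fin (n ℕ.+ k))}
           (β-agree : Agree β′ β) (γ-agree : Agree γ′ γ)
           (w-marks : Marks w 0 (S[ interval l lc hi hc ] β γ))
           (a-marks : Marks a 0 (sourceOf (interval l lc hi hc) β γ))
           (b-marks : Marks b l (sourceOf (interval l lc hi hc) β γ))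
           (e-marks : Marks e (upper (interval l lc hi hc)) (endOf (interval l lc hi hc) γ)) where

    private
      I : Interval
      I = interval l lc hi hc

    β̂ γ̂ : Form (Fin (n ℕ.+ k))
    β̂ = act ⇒ β′
    γ̂ = act ∧ γ′

    open Constraints act β̂ γ̂ w a b e

    time-cancel-≼ : ∀ c {p q} → τ′ p ≲[ c ] τ′ q → p ≼[ c ] q
    time-cancel-≼ true  = O.time-cancel-≤
    time-cancel-≼ false = O.time-cancel-<

    kill-intro : ∀ c d {r} → (∀ x → r Fin.< x → Sat ρ′ x ŵ → ∃ λ p → Sat ρ′ p b × r ≼[ c ] p × p ≼[ d ] x) →
                 Sat ρ′ r (kill c d)
    kill-intro c d {r} h (¬cb , x , r<x , (wx , ¬db) , _ , ¬b) with h x r<x wx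
    ... | p , bp , r≼p , p≼x = locate (Fin.<-cmp r p) (Fin.<-cmp p x)
      where
      self : ∀ c {i} → i ≼[ c ] p → i ≡ p → ¬ Sat ρ′ i (const c ∧ b) → ⊥
      self true  _ refl ¬b = ¬b (_ , bp)
      self false q refl _  = ℕ.<-irrefl refl q
      self′ : ∀ c {i} → p ≼[ c ] i → p ≡ i → ¬ Sat ρ′ i (const c ∧ b) → ⊥
      self′ c q refl = self c q refl
      locate : _ → _ → ⊥
      locate (tri> _ _ p<r)  _               = ℕ.<⇒≱ p<r (≼⇒≤ c r≼p)
      locate (tri≈ _ r≡p _)  _               = self c r≼p r≡p ¬cb
      locate (tri< _ _ _)    (tri> _ _ x<p)  = ℕ.<⇒≱ x<p (≼⇒≤ d p≼x)
      locate (tri< _ _ _)    (tri≈ _ p≡x _)  = self′ d p≼x p≡x ¬db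
      locate (tri< r<p _ _)  (tri< p<x _ _)  = ¬b p r<p p<x bp

    soon-elim : ∀ m {q} → 0 ℕ.< m → Sat ρ′ q (soon m) → ∃ λ p → q Fin.≤ p × τ′ p < τ′ q ⊕ m × Sat ρ′ p b
    soon-elim m {q} 0<m h with ⋎-elim {i = q} b (F[ rightOpen 0 m ] b) h
    ... | inj₁ bq = q , ℕ.≤-refl , x<x⊕n 0<m , bq
    ... | inj₂ h′ = let p , q<p , (_ , p<) , bp = F-elim {i = q} (rightOpen 0 m) b h′ in p , ℕ.<⇒≤ q<p , p< , bp

    In-gap : ∀ {i j} → i Fin.< j → Upto (Maybe.map (ℕ._∸ l) hi) (lc or hc) (τ i) (τ j) → In (gap I) (τ i) (τ j)
    In-gap i<j h = ≤-<-trans (inj₂ (⊕-identityʳ _)) (time-mono-< i<j) , h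

    BetweenAll : Form (Fin n) → Fin (length ρ) → Fin (length ρ) → Set
    BetweenAll φ s i = ∀ r → s Fin.< r → r Fin.< i → Sat ρ r φ

    -- The last conjunct serves `end-killed`: an end before the witness `k` is even before the
    -- source `s`, so that its end mark does not come after the mark of `s`.
    Descent : Fin (length ρ) → Fin (length ρ) → Set
    Descent i k = ∃ λ s → s Fin.≤ k × Sat ρ s (sourceOf I β γ) × BetweenAll β s i
                        × (∀ {j} → Sat ρ j (endOf I γ) → j Fin.< k → j Fin.< s)

    -- If k is not a source, an earlier k′ connected to it is as good a witness,
    -- and no end lies between the two.
    descend : ∀ m {i k} → toℕ k ℕ.< m → k Fin.< i → Sat ρ k γ → τ k ⊕ l ≤ τ i → BetweenAll β k i → Descent i k
    descend (suc m) {i} {k} (s≤s k≤m) k<i γk k+l≤i run = decide (Sat? ρ k (sourceOf I β γ))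
      where
      -- Since `β` holds from `k` to `i` and `τ k + l ≤ τ i`, the first two conjuncts of `sourceOf`
      -- hold at `k`; only the missing connection to the past can fail.
      earlier : ∀ l → (let I′ = interval l lc hi hc) → τ k ⊕ l ≤ τ i → ¬ Sat ρ k (sourceOf I′ β γ) →
                Sat ρ k β × ∃ λ k′ → k′ Fin.< k × Sat ρ k′ γ × In (gap I′) (τ k′) (τ k) × BetweenAll β k′ k
      earlier zero      _     ¬src = contradiction γk ¬src
      earlier l@(suc _) k+l≤i ¬src =
        let I′ = interval l lc hi hc
            βk , k′ , k′<k , (γk′ , _) , d , run′ = decidable-stable (Sat? ρ k (β ∧ S[ gap I′ ] β (enduring l β γ)))
              λ ¬conn → ¬src ((γk , enduring-k) , B.F-intro {i = k} (from l) tt k<i (k+l≤i , _) _ , ¬conn)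
        in βk , k′ , k′<k , γk′ , ∈I⇒In (gap I′) d , run′
        where
        enduring-k : ¬ Sat ρ k (F[ rightOpen 0 l ] (¬' β))
        enduring-k h = let r , k<r , (_ , r<k+l) , ¬βr = B.F-elim {i = k} (rightOpen 0 l) (¬' β) h in
                       ¬βr (run r k<r (time-cancel-< (<-≤-trans r<k+l k+l≤i)))
      decide : Dec (Sat ρ k (sourceOf I β γ)) → Descent i k
      decide (yes src) = k , ℕ.≤-refl , src , run , λ _ j<k → j<k
      decide (no ¬src) = step (earlier l k+l≤i ¬src)
        where
        step : (Sat ρ k β × ∃ λ k′ → k′ Fin.< k × Sat ρ k′ γ × In (gap I) (τ k′)
            (τ k) × BetweenAll β k′ k) → Descent i k
        step (βk , k′ , k′<k , γk′ , (_ , d) , run′) =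
          let s , s≤k′ , src , run″ , later = descend m (ℕ.<-≤-trans k′<k k≤m) (ℕ.<-trans k′<k k<i) γk′
                (≤-trans (⊕-mono-≤ l (inj₁ (time-mono-< k′<k))) k+l≤i) run-k′
          in s , ℕ.≤-trans s≤k′ (ℕ.<⇒≤ k′<k) , src , run″ , λ {j} end j<k → later {j} end (j<k′ j end j<k)
          where
          run-k′ : BetweenAll β k′ i
          run-k′ r k′<r r<i with Fin.<-cmp r k
          ... | tri< r<k _ _  = run′ r k′<r r<k
          ... | tri≈ _ refl _ = βk
          ... | tri> _ _ k<r  = run r k<r r<i
          widen : ∀ hi {y y′ x c} → y ≤ y′ → Upto hi c y x → Upto hi c y′ x
          widen nothing  _ _ = _
          widen (just h) {c = c} y≤y′ p = ≲-≤-trans c p (⊕-mono-≤ h y≤y′)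
          -- What is in reach of the gap from `k′` is in reach from any later `j` before `k`; so `k`
          -- itself shows that such a `j` is no end.
          j<k′ : ∀ j → Sat ρ j (endOf I γ) → j Fin.< k → j Fin.< k′
          j<k′ j (_ , isolated) j<k = ℕ.≰⇒> λ k′≤j →
            isolated (B.F-intro {i = j} (gap I) γ j<k
                (In-gap j<k (widen (Maybe.map (ℕ._∸ l) hi) (time-mono-≤ k′≤j) d)) γk)

    StartedBy : Fin (length ρ) → Fin (length ρ) → Set
    StartedBy i k = ∃ λ s → ∃ λ p → Sat ρ′ p b × τ s ⊕ l ≡ τ′ p × p ≼[ lc ] f i × Sat ρ s (sourceOf I β γ)
                    × BetweenAll β s i × (∀ {j} → Sat ρ j (endOf I γ) → j Fin.< k → j Fin.< s)

    started : ∀ {i k} → k Fin.< i → Sat ρ k γ → In I (τ k) (τ i) → BetweenAll β k i → StartedBy i k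
    started {i} {k} k<i γk (k+l≲i , _) run =
      let s , s≤k , src , run′ , later = descend _ ℕ.≤-refl k<i γk (≲⇒≤ lc k+l≲i) run
          s+l≲i = ≤-≲-trans lc (⊕-mono-≤ l (time-mono-≤ s≤k)) k+l≲i
          p , p≡ = exists b-marks s {i} (≲⇒≤ lc s+l≲i)
      in s , p , holds b-marks s (sym p≡) src , sym p≡ ,
         time-cancel-≼ lc (≤-≲-trans lc (inj₂ p≡) (≲-≤-trans lc s+l≲i (inj₂ (sym (f-time i))))) , src , run′ , later

    Since : Fin (length ρ) → Fin (length ρ) → Set
    Since i k = k Fin.< i × Sat ρ k γ × In I (τ k) (τ i) × BetweenAll β k i

    ŵ-elim : ∀ {x} → Sat ρ′ x ŵ → ∃ λ i → f i ≡ x × ∃ (Since i)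
    ŵ-elim (_ , wx) = let i , fi≡x , k , k<i , γk , d , run = origin₀ w-marks wx in i , fi≡x , k , k<i , γk , ∈I⇒In I d , run

    w-complete : ∀ q → Sat ρ′ q (γ̂ ⇒ ¬' (U[ I ] β̂ (act ∧ ¬' w)))
    w-complete q = ⇒-intro {i = q} γ̂ (¬' (U[ I ] β̂ (act ∧ ¬' w))) go
      where
      go : Sat ρ′ q γ̂ → ¬ Sat ρ′ q (U[ I ] β̂ (act ∧ ¬' w))
      go γq (x , q<x , (ax , ¬wx) , d , run) with some-act-elim γ-agree γq | f-act ax
      ... | j , refl , γj | i , refl = ¬wx (holds₀ w-marks i
            (j , f-cancel-< q<x , γj , In⇒∈I I (subst (λ S → S) (diff-f I j i) (∈I⇒In I d)) ,
             λ r j<r r<i → all-act-elim β-agree (run (f r) (embed-mono π j<r) (embed-mono π r<i))))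

    first-killed : ∀ q → Sat ρ′ q (BP ⇒ ¬' ŵ ∧ kill true lc)
    first-killed q = ⇒-intro {i = q} BP (¬' ŵ ∧ kill true lc) λ q≡0 →
        (λ wq → unmarked q≡0 (ŵ-elim wq)) , kill-intro true lc λ x _ wx → mark q≡0 (ŵ-elim wx)
      where
      unmarked : Sat ρ′ q BP → ¬ ∃ λ i → f i ≡ q × ∃ (Since i)
      unmarked q≡0 (i , refl , k , k<i , _) = ℕ.<⇒≱ (embed-mono π k<i) (BP⇒min {ρ = ρ′} {f i} q≡0 (f k))
      mark : Sat ρ′ q BP → ∀ {x} → (∃ λ i → f i ≡ x × ∃ (Since i)) → ∃ λ p → Sat ρ′ p b × q Fin.≤ p × p ≼[ lc ] x
      mark q≡0 (i , refl , k , k<i , γk , d , run) =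
        let s , p , bp , _ , p≼i , _ = started k<i γk d run in p , bp , BP⇒min {ρ = ρ′} {q} q≡0 p , p≼i

    -- The source behind a later `ŵ` has `β` strictly after it up to there, so it is not before the
    -- failure. Its mark is then not before the failure either, and strictly after it if `l > 0`.
    ¬β-killed : ∀ q → Sat ρ′ q (¬' β̂ ⇒ kill (isZero l) lc)
    ¬β-killed q = ⇒-intro {i = q} (¬' β̂) (kill (isZero l) lc) λ ¬β̂q →
        kill-intro (isZero l) lc λ x q<x wx → mark ¬β̂q q<x (ŵ-elim wx)
      where
      after : ∀ l {s r p} → τ s ⊕ l ≡ τ′ p → r Fin.≤ s → f r ≼[ isZero l ] p
      after zero    {s} {r} eq r≤s = O.time-cancel-≤ (≤-trans (inj₂ (f-time r)) (≤-trans (time-mono-≤ r≤s)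
                                 (inj₂ (trans (sym (⊕-identityʳ _)) eq))))
      after (suc l) {s} {r} eq r≤s = O.time-cancel-< (≤-<-trans (≤-trans (inj₂ (f-time r)) (time-mono-≤ r≤s))
                                 (<-≤-trans (x<x⊕n {n = suc l} (s≤s z≤n)) (inj₂ eq)))
      mark : ¬ Sat ρ′ q β̂ → ∀ {x} → q Fin.< x → (∃ λ i → f i ≡ x × ∃ (Since i)) →
             ∃ λ p → Sat ρ′ p b × q ≼[ isZero l ] p × p ≼[ lc ] x
      mark ¬β̂q q<x (i , refl , k , k<i , γk , d , run)
        with Fin.any? (λ r → (f r Fin.≟ q) ×-dec ¬? (Sat? ρ r β))
      ... | no ∄r = contradiction (all-act-intro β-agree {q} λ r fr≡q → decidable-stable
          (Sat? ρ r β) λ ¬βr → ∄r (r , fr≡q , ¬βr)) ¬β̂q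
      ... | yes (r , refl , ¬βr) =
        let s , p , bp , s+l≡p , p≼i , _ , run′ , _ = started k<i γk d run
        in p , bp , after l s+l≡p (ℕ.≮⇒≥ λ s<r → ¬βr (run′ r s<r (f-cancel-< q<x))) , p≼i

    module _ (u : ℕ) (hi≡u : hi ≡ just u) where

      l<u : l ℕ.< u
      l<u = subst (λ h → Proper (interval l lc h hc)) hi≡u proper

      e-origin : ∀ {q} → Sat ρ′ q e → ∃ λ j → τ j ⊕ u ≡ τ′ q × Sat ρ j (endOf I γ)
      e-origin h = let j , eq , end = origin e-marks h in
                   j , subst (λ v → τ j ⊕ Maybe.fromMaybe 0 v ≡ _) hi≡u eq , end

      isolated : ∀ {j s} → Sat ρ j (endOf I γ) → j Fin.< s → Sat ρ s γ → τ j ⊕ u ≲[ not (lc or hc) ] τ s ⊕ l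
      isolated {j} {s} (_ , ¬near) j<s γs =
        subst (_≲[ not (lc or hc) ] τ s ⊕ l) (⊕-∸ (τ j) (ℕ.<⇒≤ l<u))
            (⊕-mono-≲ (not (lc or hc)) l (≴⇒ (lc or hc) λ near →
          ¬near (B.F-intro {i = j} (gap I) γ j<s
            (In-gap j<s (subst (λ v → Upto (Maybe.map (ℕ._∸ l) v) (lc or hc) (τ j) (τ s)) (sym hi≡u) near)) γs)))

      since-upto : ∀ {i k} → In I (τ k) (τ i) → τ i ≲[ hc ] τ k ⊕ u
      since-upto {i} {k} (_ , h) = subst (λ v → Upto v hc (τ k) (τ i)) hi≡u h

      -- If `i` lies beyond the end mark of `j`, its witness `k` is later than `j`, and by `Descent`
      -- so is the source `s`. As `j` is isolated, the mark of `s` is not before the end mark.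
      end-killed : ∀ q → Sat ρ′ q (e ⇒ kill true lc ∧ (const hc ⋎ ¬' ŵ))
      end-killed q = ⇒-intro {i = q} e (kill true lc ∧ (const hc ⋎ ¬' ŵ)) λ eq →
          (kill-intro true lc λ x q<x wx → mark (e-origin eq) q<x (ŵ-elim wx)) , self hc refl (e-origin eq)
        where
        mark : (∃ λ j → τ j ⊕ u ≡ τ′ q × Sat ρ j (endOf I γ)) → ∀ {x} → q Fin.< x → (∃ λ i → f i ≡ x × ∃ (Since i)) →
               ∃ λ p → Sat ρ′ p b × q Fin.≤ p × p ≼[ lc ] x
        mark (j , j+u≡q , end) q<x (i , refl , k , k<i , γk , d , run) =
          let s , p , bp , s+l≡p , p≼i , src , _ , later = started k<i γk d run
              j<s = later {j} end j<k
          in p , bp , O.time-cancel-≤ (≤-trans (inj₂ (sym j+u≡q)) (≤-trans (≲⇒≤ (not (lc or hc))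
               (isolated end j<s (sourceOf⇒γ ℝ I β γ src))) (inj₂ s+l≡p))) , p≼i
          where
          q<i : τ′ q < τ i
          q<i = <-≤-trans (O.time-mono-< q<x) (inj₂ (f-time i))
          j<k : j Fin.< k
          j<k = ℕ.≰⇒> λ k≤j → <⇒≱ q<i (≤-trans (≲⇒≤ hc (since-upto {i} {k} d))
              (≤-trans (⊕-mono-≤ u (time-mono-≤ k≤j)) (inj₂ j+u≡q)))
        self : ∀ c → hc ≡ c → (∃ λ j → τ j ⊕ u ≡ τ′ q × Sat ρ j (endOf I γ)) → Sat ρ′ q (const c ⋎ ¬' ŵ)
        self true  _     _ = ⋎-intro {i = q} tt (¬' ŵ) (inj₁ _)
        self false hc≡ (j , j+u≡q , end) = ⋎-intro {i = q} bot (¬' ŵ) (inj₂ λ wq → absurd (ŵ-elim wq))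
          where
          absurd : ¬ ∃ λ i → f i ≡ q × ∃ (Since i)
          absurd (i , refl , k , k<i , γk , d@(k+l≲i , _) , _) =
            contra lc (subst (λ c → τ j ⊕ u ≲[ not (lc or c) ] τ k ⊕ l) hc≡ (isolated end j<k γk)) k+l≲i
            where
            i≡j+u : τ i ≡ τ j ⊕ u
            i≡j+u = trans (sym (f-time i)) (sym j+u≡q)
            j<k : j Fin.< k
            j<k = time-cancel-< (⊕-cancel-< u (≤-<-trans (inj₂ (sym i≡j+u))
                (subst (λ c → τ i ≲[ c ] τ k ⊕ u) hc≡ (since-upto {i} {k} d))))
            contra : ∀ lc → τ j ⊕ u ≲[ not (lc or false) ] τ k ⊕ l → ¬ (τ k ⊕ l ≲[ lc ] τ i)
            contra true  p q = <⇒≱ p (≤-trans q (inj₂ i≡j+u))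
            contra false p q = <⇒≱ q (≤-trans (inj₂ i≡j+u) p)

      end-marked : ∀ q → Sat ρ′ q (γ̂ ∧ ¬' (F[ gap I ] γ̂) ∧ F[ from u ] tt ⇒ F[ exactly u ] e)
      end-marked q = ⇒-intro {i = q} (γ̂ ∧ ¬' (F[ gap I ] γ̂) ∧ F[ from u ] tt) (F[ exactly u ] e)
          λ (γq , ¬near , far) → go (some-act-elim γ-agree γq) ¬near (F-elim {i = q} (from u) tt far)
        where
        go : (∃ λ j → f j ≡ q × Sat ρ j γ) → ¬ Sat ρ′ q (F[ gap I ] γ̂) →
             (∃ λ r → q Fin.< r × In (from u) (τ′ q) (τ′ r) × ⊤) → Sat ρ′ q (F[ exactly u ] e)
        -- The last position is an action point, hence the image of an original position at or after
        -- `τ j + u`, as `exists` requires.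
        go (j , refl , γj) ¬near (r , _ , (q+u≤r , _) , _) with lastPosition ρ′ r
        ... | z , zEP with f-act {z} (⇒-elim {i = z} EP act (proj₂ (framed z)) zEP)
        ... | i , refl = let p , p≡ = mark-at in
              F-intro {i = f j} (exactly u) e (j<p p≡) (inj₂ (trans (cong (_⊕ u) (f-time j)) (sym p≡)) ,
                inj₂ (trans p≡ (cong (_⊕ u) (sym (f-time j)))))
                    (holds e-marks j (trans (cong (λ v → τ j ⊕ Maybe.fromMaybe 0 v) hi≡u) (sym p≡)) (γj , isolated-j))
          where
          mark-at : ∃ λ p → τ′ p ≡ τ j ⊕ u
          mark-at = subst (λ v → ∃ λ p → τ′ p ≡ τ j ⊕ Maybe.fromMaybe 0 v) hi≡u (exists e-marks j {i}
                      (subst (λ v → τ j ⊕ Maybe.fromMaybe 0 v ≤ τ i) (sym hi≡u)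
                        (≤-trans (inj₂ (cong (_⊕ u) (sym (f-time j)))) (≤-trans q+u≤r
                          (≤-trans (O.time-mono-≤ (EP⇒max {ρ = ρ′} {f i} zEP r)) (inj₂ (f-time i)))))))
          j<p : ∀ {p} → τ′ p ≡ τ j ⊕ u → f j Fin.< p
          j<p p≡ = O.time-cancel-< (≤-<-trans (inj₂ (f-time j))
              (<-≤-trans (x<x⊕n (ℕ.≤-<-trans z≤n l<u)) (inj₂ (sym p≡))))
          isolated-j : ¬ Sat ρ j (F[ gap I ] γ)
          isolated-j h = let s , j<s , d , γs = B.F-elim {i = j} (gap I) γ h in
            ¬near (F-intro {i = f j} (gap I) γ̂ (embed-mono π j<s)
                (subst (λ S → S) (sym (diff-f (gap I) j s)) d) (some-act-intro γ-agree γs))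

    ends-hold : ∀ q → Sat ρ′ q (ends I)
    ends-hold q = go hi refl
      where
      go : ∀ h → hi ≡ h → Sat ρ′ q (ends (interval l lc h hc))
      go nothing  _  = _
      go (just u) eq = end-killed u eq q ,
        subst (λ h → Sat ρ′ q (γ̂ ∧ ¬' (F[ gap (interval l lc h hc) ] γ̂) ∧ F[ from u ] tt ⇒ F[ exactly u ] e)) eq (end-marked u eq q)

    -- `sourceOf` and `marks` branch on the lower endpoint; keeping `l` a variable with an equation
    -- leaves the hypotheses about `I` applicable.
    module _ (l′ : ℕ) (l≡ : l ≡ suc l′) where
      private
        source : Form (Fin n)
        source = enduring l β γ ∧ F[ from l ] tt ∧ ¬' (β ∧ S[ gap I ] β (enduring l β γ))

        0<l : 0 ℕ.< l
        0<l = subst (0 ℕ.<_) (sym l≡) (s≤s z≤n)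

        source≡ : sourceOf I β γ ≡ source
        source≡ = go l l≡
          where
          go : ∀ m → m ≡ suc l′ → sourceOf (interval m lc hi hc) β γ ≡
                 (enduring m β γ ∧ F[ from m ] tt ∧ ¬' (β ∧ S[ gap (interval m lc hi hc) ] β (enduring m β γ)))
          go (suc _) _ = refl

        b-origin : ∀ {p} → Sat ρ′ p b → ∃ λ s → τ s ⊕ l ≡ τ′ p × Sat ρ s source
        b-origin h = let s , eq , src = origin b-marks h in s , eq , subst (Sat ρ s) source≡ src

        enduring-elim : ∀ {s} → Sat ρ s (enduring l β γ) → ∀ r → s Fin.< r → τ r < τ s ⊕ l → Sat ρ r β
        enduring-elim {s} (_ , h) r s<r r<s+l = decidable-stable (Sat? ρ r β) λ ¬βr →
          h (B.F-intro {i = s} (rightOpen 0 l) (¬' β) s<r (In-rightOpen0 l s<r r<s+l) ¬βr)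

      first-unmarked : ∀ q → Sat ρ′ q (BP ⇒ ¬' (soon l))
      first-unmarked q = ⇒-intro {i = q} BP (¬' (soon l)) λ q≡0 sq →
        let p , _ , p<q+l , bp = soon-elim l {q} 0<l sq
            s , s+l≡p , _ = b-origin bp
        in <⇒≱ p<q+l (≤-trans (⊕-mono-≤ l (≤-trans (O.time-mono-≤ (BP⇒min {ρ = ρ′} {q} q≡0 (f s)))
            (inj₂ (f-time s)))) (inj₂ s+l≡p))

      gap-unmarked : ∀ q → Sat ρ′ q (¬' (F[ closed 0 l ] tt) ⇒ ¬' (U[ from 0 ] bot (soon l)))
      gap-unmarked q = ⇒-intro {i = q} (¬' (F[ closed 0 l ] tt)) (¬' (U[ from 0 ] bot (soon l))) go
        where
        go : ¬ Sat ρ′ q (F[ closed 0 l ] tt) → ¬ Sat ρ′ q (U[ from 0 ] bot (soon l))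
        go far (q′ , q<q′ , sq′ , _ , empty) =
          let p , q′≤p , p<q′+l , bp = soon-elim l {q′} 0<l sq′
              s , s+l≡p , _ = b-origin bp
              s<q′ = O.time-cancel-< (≤-<-trans (inj₂ (f-time s)) (⊕-cancel-< l (≤-<-trans (inj₂ s+l≡p) p<q′+l)))
              s≤q = ℕ.≮⇒≥ λ q<s → empty (f s) q<s s<q′ _
              p≤q+l = ≤-trans (inj₂ (sym s+l≡p)) (⊕-mono-≤ l (≤-trans (inj₂ (sym (f-time s))) (O.time-mono-≤ s≤q)))
          in far (F-intro {i = q} (closed 0 l) tt q<q′
              (proj₁ (O.In-from0 q<q′) , ≤-trans (O.time-mono-≤ q′≤p) p≤q+l) _)

      source-enduring : ∀ q → Sat ρ′ q (a ⇒ γ̂ ∧ ¬' (F[ rightOpen 0 l ] (¬' β̂)))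
      source-enduring q = ⇒-intro {i = q} a (γ̂ ∧ ¬' (F[ rightOpen 0 l ] (¬' β̂))) λ aq → go (origin₀ a-marks aq)
        where
        go : (∃ λ s → f s ≡ q × Sat ρ s (sourceOf I β γ)) → Sat ρ′ q (γ̂ ∧ ¬' (F[ rightOpen 0 l ] (¬' β̂)))
        go (s , refl , src) with subst (Sat ρ s) source≡ src
        ... | end@(γs , _) , _ = some-act-intro γ-agree γs , λ h →
          let r , s<r , (_ , r<s+l) , ¬βr = F-elim {i = f s} (rightOpen 0 l) (¬' β̂) h in
          ¬βr (all-act-intro β-agree {r} λ { i refl → enduring-elim end i (f-cancel-< s<r)
                 (≤-<-trans (inj₂ (sym (f-time i))) (<-≤-trans r<s+l (inj₂ (cong (_⊕ l) (f-time s))))) })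

      source-marked : ∀ q → Sat ρ′ q (a ⇒ F[ exactly l ] b)
      source-marked q = ⇒-intro {i = q} a (F[ exactly l ] b) λ aq → go (origin₀ a-marks aq)
        where
        go : (∃ λ s → f s ≡ q × Sat ρ s (sourceOf I β γ)) → Sat ρ′ q (F[ exactly l ] b)
        go (s , refl , src) with subst (Sat ρ s) source≡ src
        ... | _ , fits , _ =
          let i , _ , (s+l≤i , _) , _ = B.F-elim {i = s} (from l) tt fits
              p , p≡ = exists b-marks s {i} s+l≤i
              fs+l≡p = trans (cong (_⊕ l) (f-time s)) (sym p≡)
          in F-intro {i = f s} (exactly l) b (O.time-cancel-< (<-≤-trans (x<x⊕n 0<l) (inj₂ fs+l≡p)))
               (inj₂ fs+l≡p , inj₂ (sym fs+l≡p)) (holds b-marks s (sym p≡) src)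

      -- Two sources less than one unit apart would be connected: the earlier one endures for
      -- `l ≥ 1` units, so `β` holds up to and at the later one, and `u - l ≥ 1` puts the later one
      -- into the gap of the earlier. Here properness and the integer endpoints enter.
      marks-sparse : ∀ q → Sat ρ′ q (b ⇒ ¬' (F[ rightOpen 0 1 ] b))
      marks-sparse q = ⇒-intro {i = q} b (¬' (F[ rightOpen 0 1 ] b)) λ bq h →
        let p , q<p , (_ , p<q+1) , bp = F-elim {i = q} (rightOpen 0 1) b h in
        go (b-origin bq) q<p p<q+1 (b-origin bp)
        where
        go : ∀ {p} → (∃ λ s → τ s ⊕ l ≡ τ′ q × Sat ρ s source) → q Fin.< p → τ′ p < τ′ q ⊕ 1 →
             (∃ λ s → τ s ⊕ l ≡ τ′ p × Sat ρ s source) → ⊥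
        go {p} (s , s+l≡q , end , _) q<p p<q+1 (s′ , s′+l≡p , _ , _ , ¬conn) =
          ¬conn (run s′ s<s′ ≤-refl , s , s<s′ , end , In⇒∈I (gap I) (In-gap s<s′ (near hi proper)) ,
                 λ r s<r r<s′ → run r s<r (inj₁ (time-mono-< r<s′)))
          where
          s<s′ : s Fin.< s′
          s<s′ = time-cancel-< (⊕-cancel-< l (≤-<-trans (inj₂ s+l≡q)
              (<-≤-trans (O.time-mono-< q<p) (inj₂ (sym s′+l≡p)))))
          s′<s+1 : τ s′ < τ s ⊕ 1
          s′<s+1 = ⊕-cancel-< l (≤-<-trans (inj₂ s′+l≡p) (<-≤-trans p<q+1 (inj₂
            (trans (cong (_⊕ 1) (sym s+l≡q)) (trans (⊕-⊕ _ l 1)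
                (trans (cong (τ s ⊕_) (ℕ.+-comm l 1)) (sym (⊕-⊕ _ 1 l))))))))
          run : ∀ r → s Fin.< r → τ r ≤ τ s′ → Sat ρ r β
          run r s<r r≤s′ = enduring-elim end r s<r (≤-<-trans r≤s′ (<-≤-trans s′<s+1 (⊕-monoʳ-≤ (τ s) 0<l)))
          near : ∀ hi → Proper (interval l lc hi hc) → Upto (Maybe.map (ℕ._∸ l) hi) (lc or hc) (τ s) (τ s′)
          near nothing  _   = _
          near (just u) l<u = <⇒≲ (lc or hc) (<-≤-trans s′<s+1 (⊕-monoʳ-≤ (τ s) (ℕ.m<n⇒0<n∸m l<u)))

      windows : ∀ q j → j ℕ.< l → Sat ρ′ q (window l j)
      windows q j _ = ⇒-intro {i = q} (F[ rightOpen (l ℕ.+ j) (l ℕ.+ suc j) ] b)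
          ((const (isZero j) ∧ a) ⋎ F[ rightOpen j (suc j) ] a) λ h →
        let p , _ , (lo , hi) , bp = F-elim {i = q} (rightOpen (l ℕ.+ j) (l ℕ.+ suc j)) b h in go (origin b-marks bp) lo hi
        where
        shift : ∀ j → τ′ q ⊕ (l ℕ.+ j) ≡ τ′ q ⊕ j ⊕ l
        shift j = trans (cong (τ′ q ⊕_) (ℕ.+-comm l j)) (sym (⊕-⊕ _ j l))
        go : ∀ {p} → (∃ λ s → τ s ⊕ l ≡ τ′ p × Sat ρ s (sourceOf I β γ)) →
             τ′ q ⊕ (l ℕ.+ j) ≤ τ′ p → τ′ p < τ′ q ⊕ (l ℕ.+ suc j) → Sat ρ′ q
                 ((const (isZero j) ∧ a) ⋎ F[ rightOpen j (suc j) ] a)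
        go {p} (s , s+l≡p , src) lo hi = ⋎-intro {i = q} (const (isZero j) ∧ a) (F[ rightOpen j (suc j) ] a)
            (decide (q Fin.≟ f s))
          where
          q+j≤s : τ′ q ⊕ j ≤ τ′ (f s)
          q+j≤s = ≤-trans (⊕-cancel-≤ l (≤-trans (inj₂ (sym (shift j))) (≤-trans lo (inj₂ (sym s+l≡p)))))
              (inj₂ (sym (f-time s)))
          s<q+j+1 : τ′ (f s) < τ′ q ⊕ suc j
          s<q+j+1 = ≤-<-trans (inj₂ (f-time s)) (⊕-cancel-< l
              (≤-<-trans (inj₂ s+l≡p) (<-≤-trans hi (inj₂ (shift (suc j))))))
          self : ∀ j → q ≡ f s → τ′ q ⊕ j ≤ τ′ (f s) → Sat ρ′ q (const (isZero j))
          self zero    _    _ = _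
          self (suc j) refl h = λ _ → <⇒≱ (x<x⊕n {n = suc j} (s≤s z≤n)) h
          decide : Dec (q ≡ f s) → _
          decide (yes q≡fs) = inj₁ (self j q≡fs q+j≤s , subst (λ x → Sat ρ′ x a) (sym q≡fs) (holds₀ a-marks s src))
          decide (no q≢fs)  = inj₂ (F-intro {i = q} (rightOpen j (suc j)) a
            (Fin.≤∧≢⇒< (O.time-cancel-≤ (≤-trans (x≤x⊕n j) q+j≤s)) q≢fs) (q+j≤s , s<q+j+1) (holds₀ a-marks s src))

    zero-marked : l ≡ 0 → ∀ q → Sat ρ′ q (b ⇒ γ̂)
    zero-marked l≡0 q = ⇒-intro {i = q} b γ̂ λ bq → go (origin b-marks bq)
      where
      go : (∃ λ s → τ s ⊕ l ≡ τ′ q × Sat ρ s (sourceOf I β γ)) → Sat ρ′ q γ̂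
      go (s , s+l≡q , src) = subst (λ x → Sat ρ′ x γ̂)
          (at-time (trans (sym (⊕-identityʳ _)) (subst (λ m → τ s ⊕ m ≡ τ′ q) l≡0 s+l≡q)))
                               (some-act-intro γ-agree (sourceOf⇒γ ℝ I β γ src))

    marks-hold : ∀ q → Sat ρ′ q (marks l)
    marks-hold q = go l refl
      where
      go : ∀ m → l ≡ m → Sat ρ′ q (marks m)
      go zero     eq = zero-marked eq q
      go (suc l′) eq = subst (λ m → Sat ρ′ q
          ((BP ⇒ ¬' (soon m)) ∧ (¬' (F[ closed 0 m ] tt) ⇒ ¬' (U[ from 0 ] bot (soon m)))
          ∧ (a ⇒ γ̂ ∧ ¬' (F[ rightOpen 0 m ] (¬' β̂))) ∧ (a ⇒ F[ exactly m ] b)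
          ∧ (b ⇒ ¬' (F[ rightOpen 0 1 ] b)) ∧ ⋀< m (window m))) eq
        ( first-unmarked l′ eq q , gap-unmarked l′ eq q , source-enduring l′ eq q , source-marked l′ eq q
        , marks-sparse l′ eq q , ⋀<-intro {i = q} l (window l) (windows l′ eq q))

    own-holds : ∀ q → Sat ρ′ q (own I)
    own-holds q = marks-hold q , w-complete q , first-killed q , ¬β-killed q , ends-hold q

-- A new letter of meaning (c , χ) labels exactly the times t such that χ holds at time t − c of the original word.
meaning : ∀ {A} (φ : Form A) → Fin (size φ) → ℕ × Form A
meaning (φ ∧ ψ)      x = [ meaning φ , meaning ψ ]′ (Fin.splitAt (size φ) x)
meaning (¬' φ)       x = meaning φ x
meaning (U[ I ] φ ψ) x = [ meaning φ , meaning ψ ]′ (Fin.splitAt (size φ) x)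
meaning (S[ I ] φ ψ) zero                   = 0 , S[ normalise I ] φ ψ
meaning (S[ I ] φ ψ) (suc zero)             = 0 , sourceOf (normalise I) φ ψ
meaning (S[ I ] φ ψ) (suc (suc zero))       = Interval.lo (normalise I) , sourceOf (normalise I) φ ψ
meaning (S[ I ] φ ψ) (suc (suc (suc zero))) = upper (normalise I) , endOf (normalise I) ψ
meaning (S[ I ] φ ψ) (suc (suc (suc (suc x)))) = [ meaning φ , meaning ψ ]′ (Fin.splitAt (size φ) x)

-- Induction on the formula: all constraints hold under the intended labels.

module Interpretation (ℝ : RealLine) {n k : ℕ} {ρ′ : Semantics.Word ℝ (n ℕ.+ k)} {ρ : Semantics.Word ℝ n}
    (π : Projection.Proj ℝ n ρ′ ρ) (sorted′ : Words.Sorted ℝ ρ′) (sorted : Words.Sorted ℝ ρ)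
    (framed : ∀ p → Semantics.Sat ℝ ρ′ p (Translation.wellFramed n k)) where
  open Semantics ℝ
  open Line ℝ
  open Words ℝ
  open Projection ℝ
  open Correctness π sorted′ framed
  open Completeness ℝ π sorted′ sorted framed

  Interprets : ∀ {m} → (Fin m → Fin (n ℕ.+ k)) → (Fin m → ℕ × Form (Fin n)) → Set
  Interprets e v = ∀ x → Marks (atom (e x)) (proj₁ (v x)) (proj₂ (v x))

  interprets-left : ∀ m {m′} {e : Fin (m ℕ.+ m′) → Fin (n ℕ.+ k)} {v v′} →
                    Interprets e ([ v , v′ ]′ ∘ Fin.splitAt m) → Interprets (leftOf m′ e) v
  interprets-left m {m′} {e} {v} {v′} h x =
    subst (λ y → Marks (atom (e (x ↑ˡ m′))) (proj₁ ([ v , v′ ]′ y)) (proj₂ ([ v , v′ ]′ y)))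
        (Fin.splitAt-↑ˡ m x m′) (h (x ↑ˡ m′))

  interprets-right : ∀ m {m′} {e : Fin (m ℕ.+ m′) → Fin (n ℕ.+ k)} {v v′} →
                     Interprets e ([ v , v′ ]′ ∘ Fin.splitAt m) → Interprets (rightOf m e) v′
  interprets-right m {m′} {e} {v} {v′} h x =
    subst (λ y → Marks (atom (e (m ↑ʳ x))) (proj₁ ([ v , v′ ]′ y)) (proj₂ ([ v , v′ ]′ y)))
        (Fin.splitAt-↑ʳ m m′ x) (h (m ↑ʳ x))

  define-holds : ∀ I β γ e → NonSingular I → let open Letters β γ e in
                 Agree (translate β eβ) β → Agree (translate γ eγ) γ →
                 Interprets e (meaning (S[ I ] β γ)) → ∀ p → Sat ρ′ p (define I)
  define-holds I β γ e ns aβ aγ h p with proper? I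
  ... | yes proper = holdsFor (normalise I) (normalise-proper I proper)
                       (h zero) (h (suc zero)) (h (suc (suc zero))) (h (suc (suc (suc zero))))
    where
    open Letters β γ e
    holdsFor : ∀ J → Proper J → Marks (atom (e zero)) 0 (S[ J ] β γ) → Marks (atom (e (suc zero))) 0
        (sourceOf J β γ) →
               Marks (atom (e (suc (suc zero)))) (Interval.lo J) (sourceOf J β γ) →
               Marks (atom (e (suc (suc (suc zero))))) (upper J) (endOf J γ) → Sat ρ′ p (own J)
    holdsFor (interval l lc hi hc) proper w a b e = own-holds l lc hi hc proper aβ aγ w a b e p
  ... | no ¬proper = λ wp → let _ , _ , _ , _ , _ , d , _ = origin₀ (h zero) wp in
                       improper-empty I ns ¬proper (normalise-In⇒ I (∈I⇒In (normalise I) d))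

  -- The constraints of a since mention the translations of its operands. Those of the operands are
  -- therefore established before, which makes `translate-correct` available for them.
  constraints-hold : ∀ {φ} → SinceNS φ → ∀ e → Interprets e (meaning φ) → ∀ p → Sat ρ′ p (constraints φ e)
  constraints-hold (atom x) e h p = _
  constraints-hold BP e h p = _
  constraints-hold EP e h p = _
  constraints-hold tt e h p = _
  constraints-hold (_∧_ {φ} φ′ ψ′) e h p =
    constraints-hold φ′ _ (interprets-left (size φ) h) p , constraints-hold ψ′ _ (interprets-right (size φ) h) p
  constraints-hold (¬' φ′) e h p = constraints-hold φ′ e h p
  constraints-hold (U[_] I {φ} φ′ ψ′) e h p =
    constraints-hold φ′ _ (interprets-left (size φ) h) p , constraints-hold ψ′ _ (interprets-right (size φ) h) p
  constraints-hold (S[_] {I} {β} {γ} ns β′ γ′) e h p =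
      define-holds I β γ e ns (translate-correct β′ _ βholds)
          (translate-correct γ′ _ γholds) h p , βholds p , γholds p
    where
    sub : Interprets (rightOf 4 e) ([ meaning β , meaning γ ]′ ∘ Fin.splitAt (size β))
    sub x = h (suc (suc (suc (suc x))))
    βholds : ∀ p → Sat ρ′ p (constraints β _)
    βholds = constraints-hold β′ _ (interprets-left (size β) sub)
    γholds : ∀ p → Sat ρ′ p (constraints γ _)
    γholds = constraints-hold γ′ _ (interprets-right (size β) sub)

-- The formula and its two properties.

module Construction (n : ℕ) (φ : Form (Fin n)) (ns : SinceNS φ) where
  k : ℕ
  -- The additional letter is the one that holds everywhere in the oversampled word.
  k = suc (size φ)

  open Translation n k

  letter : Fin (size φ) → Fin (n ℕ.+ k)
  letter x = n ↑ʳ suc x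

  invariant ψ : Form (Fin (n ℕ.+ k))
  invariant = wellFramed ∧ constraints φ letter
  ψ = translate φ letter ∧ □ invariant

  ψᶠ : FutureOnly ψ
  ψᶠ = translateᶠ φ letter ∧ □ᶠ (((BP ⇒ᶠ actᶠ) ∧ (EP ⇒ᶠ actᶠ)) ∧ constraintsᶠ φ letter)

  module _ (ℝ : RealLine) where
    open Semantics ℝ
    open Line ℝ
    open Words ℝ
    open Projection ℝ

    at-first : ∀ {m} (σ : Word m) χ {i} → toℕ i ≡ 0 → Sat σ i χ → σ ⊨ χ
    at-first (_ ∷ _) χ {zero} _ h = h

    □-elim : ∀ {m} (x : _ × _) (σ : Word m) → Sorted (x ∷ σ) → ∀ χ → Sat (x ∷ σ) zero (□ χ) → ∀ p → Sat (x ∷ σ) p χ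
    □-elim x σ sorted χ (h , _)  zero    = h
    □-elim x σ sorted χ (_ , ¬F) (suc p) = decidable-stable (Sat? (x ∷ σ) (suc p) χ) λ ¬h →
      ¬F (Logic.F-intro (x ∷ σ) {i = zero} (from 0) (¬' χ) (s≤s z≤n)
          (Order.In-from0 (x ∷ σ) sorted {zero} {suc p} (s≤s z≤n)) ¬h)

    project : (ρ′ : Word (n ℕ.+ k)) → IsTimedWord ρ′ → ρ′ ⊨ ψ → proj n ρ′ ⊨ φ
    project ρ′@(x ∷ σ) (_ , _ , _ , sorted) (h , always) =
      -- The first position is an action point, hence an image; this also shows that the projection
      -- is not empty.
      let i , fi≡0 = C.f-act {zero} (Logic.⇒-elim ρ′ {i = zero} BP act (proj₁ (framed zero)) refl)
          h′ = proj₁ (C.translate-correct ns letter (λ p → proj₂ (inv p)) i)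
              (subst (λ p → Sat ρ′ p (translate φ letter)) (sym fi≡0) h)
      in at-first (proj n ρ′) φ (proj₁ (C.agree-BP i) (cong toℕ fi≡0)) h′
      where
      inv : ∀ p → Sat ρ′ p invariant
      inv = □-elim x σ sorted invariant always
      framed : ∀ p → Sat ρ′ p wellFramed
      framed p = proj₁ (inv p)
      module C = Correctness (proj-Proj n ρ′) sorted framed

    ActionEnds : Word (n ℕ.+ k) → Set
    ActionEnds ρ′ = (∀ x → List.head ρ′ ≡ just x → ActionPoint n x) × (∀ x → List.last ρ′ ≡ just x → ActionPoint n x)

    action⇒act : ∀ (ρ′ : Word (n ℕ.+ k)) {p} → ActionPoint n (List.lookup ρ′ p) → Sat ρ′ p act
    action⇒act ρ′ {p} (x , x∈) = Logic.⋁-intro ρ′ n (λ x → atom (x ↑ˡ k)) x (∈-take⇒ n _ x∈)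

    action⇒framed : ∀ (ρ′ : Word (n ℕ.+ k)) → ActionEnds ρ′ → ∀ p → Sat ρ′ p wellFramed
    action⇒framed ρ′@(x ∷ σ) (headAct , lastAct) p =
        Logic.⇒-intro ρ′ {i = p} BP act (first-act p)
      , Logic.⇒-intro ρ′ {i = p} EP act λ eq → action⇒act ρ′ {p} (lastAct _ (last-lookup ρ′ p eq))
      where
      first-act : ∀ p → toℕ p ≡ 0 → Sat ρ′ p act
      first-act zero _ = action⇒act ρ′ {zero} (headAct x refl)

    oversample : (ρ : Word n) → IsTimedWord ρ → ρ ⊨ φ →
                 ∃ λ (ρ′ : Word (n ℕ.+ k)) → IsTimedWord ρ′ × ρ′ ⊨ ψ × Oversampling n ρ′ ρ
    oversample ρ@(x ∷ ρ₁) timed h = O.ρ′ , O.timed′ ,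
        (start , inv zero , λ (p , _ , ¬inv , _) → ¬inv (inv p)) , O.oversampling
      where
      module O = Oversampled ℝ x ρ₁ timed (meaning φ)
      framed : ∀ p → Sat O.ρ′ p wellFramed
      framed = action⇒framed O.ρ′ (proj₂ O.oversampling)
      π : Proj n O.ρ′ ρ
      π = subst (Proj n O.ρ′) (proj₁ O.oversampling) (proj-Proj n O.ρ′)
      sorted : Sorted ρ
      sorted = proj₂ (proj₂ (proj₂ timed))
      module C = Correctness π O.sorted′ framed
      module J = Interpretation ℝ π O.sorted′ sorted framed
      interprets : J.Interprets letter (meaning φ)
      interprets x = record
        { origin = λ {p} → O.letter⇒means {p} x
        ; holds  = λ {p} i eq s → O.means⇒letter {p} x (i , eq , s)
        ; exists = λ i {i′} → O.mark-position x i i′ }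
      holds : ∀ p → Sat O.ρ′ p (constraints φ letter)
      holds = J.constraints-hold ns letter interprets
      inv : ∀ p → Sat O.ρ′ p invariant
      inv p = framed p , holds p
      start : Sat O.ρ′ zero (translate φ letter)
      start = subst (λ p → Sat O.ρ′ p (translate φ letter)) first≡
          (proj₂ (C.translate-correct ns letter holds zero) h)
        where
        first≡ : C.f zero ≡ zero
        first≡ = Fin.toℕ-injective (proj₂ (C.agree-BP zero) refl)

open import Data.Nat using (_+_)

theorem1 : (n : ℕ) (φ : Form (Fin n)) → SinceNS φ →
    Σ ℕ λ k → Σ (Form (Fin (n + k))) λ ψ → FutureOnly ψ ×
    ((ℝ : RealLine) → let open Semantics ℝ in
    ((ρ' : Word (n + k)) → IsTimedWord ρ' → ρ' ⊨ ψ → proj n ρ' ⊨ φ)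
    × ((ρ : Word n) → IsTimedWord ρ → ρ ⊨ φ →
    ∃ λ (ρ' : Word (n + k)) → IsTimedWord ρ' × ρ' ⊨ ψ × Oversampling n ρ' ρ))
theorem1 n φ ns = k , ψ , ψᶠ , λ ℝ → project ℝ , oversample ℝ
  where open Construction n φ ns
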